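{- There are no $5$-vertex-critical $(\text{co-gem}, K_4)$-free graphs.
   Context: All graphs are finite and simple. $\chi(G)$ denotes the chromatic number of $G$. A graph $G$ is $k$-vertex-critical if $\chi(G)=k$ and $\chi(G-v)<k$ for every $v\in V(G)$. $P_n$ denotes the path on $n$ vertices, $K_n$ the complete graph on $n$ vertices, and $G+H$ the disjoint union of graphs $G$ and $H$. The co-gem is the graph $P_4+P_1$. A graph is $(H_1,\dots,H_m)$-free if none of $H_1,\dots,H_m$ is isomorphic to an induced subgraph of it. -}

module Defs where

open import Data.Fin using (Fin; toℕ)
open import Data.Fin.Properties as Fin using ()
open import Data.Fin.Subset using (Subset; _∈_; ⊤) renaming (_-_ to _∖_)
open import Data.Nat using (ℕ; suc; _≤_; _<_)
open import Data.Nat.Properties as ℕ using ()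
open import Data.Product using (∃-syntax; Σ-syntax; _×_; proj₁)
open import Data.Sum using (_⊎_; inj₁; inj₂; swap)
open import Data.Sum.Relation.Binary.Pointwise
  using (Pointwise; inj₁; inj₂; ⊎-symmetric; ⊎-decidable)
open import Function.Bundles using (_↔_; _⇔_; Inverse)
open import Level using (0ℓ)
open import Relation.Binary using (Rel; Symmetric; Irreflexive; Decidable)
open import Relation.Binary.PropositionalEquality
  using (_≡_; _≢_; refl; cong; ≢-sym)
open import Relation.Nullary using (¬_)
open import Relation.Nullary.Decidable using (¬?; _⊎-dec_)

-- Decidability of adjacency is classically automatic.  Finiteness is imposed
-- by taking the vertex set to be Fin n.
record Graph (V : Set) : Set₁ where
  field
    Adj    : Rel V 0ℓ
    symm   : Symmetric Adj
    irrefl : Irreflexive _≡_ Adj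
    adj?   : Decidable Adj

open Graph

private variable
  V W : Set
  n   : ℕ

_≅_ : Graph V → Graph W → Set
_≅_ {V} {W} G H =
  Σ[ f ∈ V ↔ W ] (∀ u v → Adj G u v ⇔ Adj H (Inverse.to f u) (Inverse.to f v))

_[_] : Graph (Fin n) → (S : Subset n) → Graph (∃[ v ] v ∈ S)
G [ S ] = record
  { Adj    = λ u v → Adj G (proj₁ u) (proj₁ v)
  ; symm   = symm G
  ; irrefl = λ u≡v → irrefl G (cong proj₁ u≡v)
  ; adj?   = λ u v → adj? G (proj₁ u) (proj₁ v)
  }

_-_ : Graph (Fin n) → (v : Fin n) → Graph (∃[ u ] u ∈ ⊤ ∖ v)
G - v = G [ ⊤ ∖ v ]

_-Free_ : Graph W → Graph (Fin n) → Set
H -Free G = ¬ (∃[ S ] H ≅ (G [ S ]))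

Colourable : ℕ → Graph V → Set
Colourable {V} k G = Σ[ c ∈ (V → Fin k) ] (∀ u v → Adj G u v → c u ≢ c v)

χ_is_ : Graph V → ℕ → Set
χ G is k = Colourable k G × (∀ j → Colourable j G → k ≤ j)

χ_below_ : Graph V → ℕ → Set
χ G below k = ∃[ j ] (χ G is j) × j < k

VertexCritical : ℕ → Graph (Fin n) → Set
VertexCritical k G = (χ G is k) × (∀ v → χ (G - v) below k)

P : (n : ℕ) → Graph (Fin n)
P n = record
  { Adj    = λ i j → suc (toℕ i) ≡ toℕ j ⊎ suc (toℕ j) ≡ toℕ i
  ; symm   = swap
  ; irrefl = λ { refl (inj₁ eq) → ℕ.1+n≢n eq ; refl (inj₂ eq) → ℕ.1+n≢n eq }
  ; adj?   = λ i j → (suc (toℕ i) ℕ.≟ toℕ j) ⊎-dec (suc (toℕ j) ℕ.≟ toℕ i)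
  }

K : (n : ℕ) → Graph (Fin n)
K n = record
  { Adj    = _≢_
  ; symm   = ≢-sym
  ; irrefl = λ u≡v u≢v → u≢v u≡v
  ; adj?   = λ i j → ¬? (i Fin.≟ j)
  }

_+_ : Graph V → Graph W → Graph (V ⊎ W)
G + H = record
  { Adj    = Pointwise (Adj G) (Adj H)
  ; symm   = ⊎-symmetric (symm G) (symm H)
  ; irrefl = λ { refl (inj₁ a) → irrefl G refl a ; refl (inj₂ a) → irrefl H refl a }
  ; adj?   = ⊎-decidable (adj? G) (adj? H)
  }

co-gem : Graph (Fin 4 ⊎ Fin 1)
co-gem = P 4 + P 1

{-# OPTIONS --safe #-}
module Submission where

-- Every (co-gem, K₄)-free graph G is 4-colourable, by induction on the number of vertices.  The
-- non-neighbours of a vertex induce a P₄-free graph, and first-fit colours a P₄-free graph H with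
-- ω(H) colours.
--
-- Suppose that G contains a co-diamond K₂ + 2K₁.  Let Q be a maximal set that induces a disconnected
-- graph with an edge and is anticomplete to some vertex v ∉ Q.  By maximality the other
-- non-neighbours of v are complete to Q.  A vertex that meets a component of Q without being complete
-- to it is complete to the other components, and this controls the remaining vertices well enough to
-- 4-colour G, except when some isolated vertex of Q can be merged with v; merging then preserves
-- co-gem-freeness and K₄-freeness, and the induction hypothesis applies.
--
-- Suppose that G has no co-diamond.  If it contains 4K₁, the common non-neighbours of two of these
-- four vertices form an independent set whose complement is triangle-free, hence 3-colourable.
-- Otherwise G has at most 10 vertices, and an exhaustive search finishes the proof.

open import Defs
open import Data.Bool as Bool using (Bool; true; false; T; if_then_else_; _∧_; _∨_; not)
open import Data.Bool.Properties using (T?)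
open import Data.Empty using (⊥; ⊥-elim)
open import Data.Fin as Fin using (Fin; zero; suc; punchIn; punchOut; _↑ˡ_; _↑ʳ_)
open import Data.Fin.Patterns using (0F; 1F; 2F; 3F)
open import Data.Fin.Properties as Fin using (any?; all?; _≟_)
open import Data.Fin.Subset as Subset using (Subset; _∈_; _∉_; ⁅_⁆)
import Data.Fin.Subset.Properties as Subset
open import Data.List as List using (List; []; _∷_; allFin; filter; map; concatMap; null; filterᵇ)
import Data.List.Membership.Propositional as List hiding (find)
open import Data.List.Membership.Propositional using (find)
open import Data.List.Membership.Propositional.Properties
  using (∈-filter⁺; ∈-filter⁻; ∈-allFin; ∈-concatMap⁻; ∈-map⁻)
import Data.List.Membership.DecPropositional as DecMembership
import Data.List.Properties as List
open import Data.List.Relation.Unary.Any using (here; there)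
open import Data.List.Relation.Unary.All as All using (All; []; _∷_)
open import Data.List.Relation.Unary.All.Properties using (all-filter)
open import Data.Nat using (ℕ; zero; suc; s≤s; z≤n)
import Data.Nat as ℕ
import Data.Nat.Properties as ℕ
open import Data.Product using (Σ-syntax; ∃; ∃-syntax; _×_; _,_; proj₁; proj₂)
open import Data.Sum as Sum using (_⊎_; inj₁; inj₂)
open import Data.Sum.Properties using (≡-dec)
open import Data.Vec using (tabulate)
open import Data.Vec.Properties using (lookup∘tabulate; lookup⇒[]=; []=⇒lookup)
open import Data.Vec.Properties.WithK using ([]=-irrelevant)
open import Function using (_∘_; id)
open import Function.Bundles using (mk⇔; mk↔ₛ′)
open import Level using (0ℓ)
open import Relation.Binary.PropositionalEquality hiding ([_])
open import Relation.Nullary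
  using (¬_; Dec; yes; no; does; contradiction; ¬?; _×-dec_; _⊎-dec_; _→-dec_)
open import Relation.Nullary.Decidable using (dec-true; dec-false; decidable-stable; map′; toWitness)
open import Relation.Unary using (Pred; Decidable; _∪_; _⊆_)

open Graph

private variable
  V : Set
  n   : ℕ

-- Induced subgraphs given by maps

-- In a twin-free graph distinct vertices are separated by their neighbours, so a map that
-- preserves and reflects adjacency is injective.
TwinFree : Graph V → Set
TwinFree H = ∀ w w′ → (∀ x → does (adj? H w x) ≡ does (adj? H w′ x)) → w ≡ w′

induced : (H : Graph V) (G : Graph (Fin n)) (f : V → Fin n) → TwinFree H →
          (∀ v → Dec (∃[ w ] f w ≡ v)) →
          (∀ w w′ → does (adj? H w w′) ≡ does (adj? G (f w) (f w′))) →
          ∃[ S ] H ≅ (G [ S ])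
induced {V = V} {n = n} H G f twinFree image? f-adj =
  S , mk↔ₛ′ to from to∘from from∘to , λ w w′ →
    mk⇔ (dec-transfer (adj? H w w′) (adj? G (f w) (f w′)) (f-adj w w′))
        (dec-transfer (adj? G (f w) (f w′)) (adj? H w w′) (sym (f-adj w w′)))
  where
  dec-transfer : {A B : Set} (a? : Dec A) (b? : Dec B) → does a? ≡ does b? → A → B
  dec-transfer a? (yes b) _ _ = b
  dec-transfer (no ¬a) (no _) _ a = contradiction a ¬a

  S : Subset n
  S = tabulate (λ v → does (image? v))

  to : V → ∃[ v ] v ∈ S
  to w = f w , lookup⇒[]= (f w) S
    (trans (lookup∘tabulate _ (f w)) (dec-true (image? (f w)) (w , refl)))

  preimage : (v : ∃[ v ] v ∈ S) → ∃[ w ] f w ≡ proj₁ v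
  preimage (v , v∈S)
    with image? v | trans (sym (lookup∘tabulate (λ v → does (image? v)) v)) ([]=⇒lookup v∈S)
  ... | yes p | _ = p

  from : (∃[ v ] v ∈ S) → V
  from v = proj₁ (preimage v)

  to∘from : ∀ v → to (from v) ≡ v
  to∘from v@(_ , v∈S) with preimage v
  ... | w , refl = cong (f w ,_) ([]=-irrelevant _ v∈S)

  from∘to : ∀ w → from (to w) ≡ w
  from∘to w = twinFree _ w λ x →
    trans (f-adj _ x) (trans (cong (λ v → does (adj? G v (f x))) (proj₂ (preimage (to w)))) (sym (f-adj w x)))

-- Forbidden subgraphs as conditions on adjacency

module Adjacency {n : ℕ} (G : Graph (Fin n)) where

  infix 4 _~_ _≁_
  _~_ _≁_ : Fin n → Fin n → Set
  u ~ v = Adj G u v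
  u ≁ v = ¬ u ~ v

  ~-sym : ∀ {u v} → u ~ v → v ~ u
  ~-sym = symm G

  ≁-sym : ∀ {u v} → u ≁ v → v ≁ u
  ≁-sym u≁v = u≁v ∘ ~-sym

  ~-irrefl : ∀ {u} → u ≁ u
  ~-irrefl = irrefl G refl

  _~?_ : ∀ u v → Dec (u ~ v)
  _~?_ = adj? G

  record P₄ (a b c d : Fin n) : Set where
    constructor path
    field
      a~b : a ~ b
      b~c : b ~ c
      c~d : c ~ d
      a≁c : a ≁ c
      a≁d : a ≁ d
      b≁d : b ≁ d

  -- The adjacencies and nonadjacencies by themselves force the listed vertices to be distinct.
  NoCoGem NoK₄ : Set
  NoCoGem = ∀ {a b c d e} → P₄ a b c d → e ≁ a → e ≁ b → e ≁ c → e ≁ d → ⊥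
  NoK₄ = ∀ {a b c d} → a ~ b → a ~ c → a ~ d → b ~ c → b ~ d → c ~ d → ⊥

  K₄-Free⇒NoK₄ : K 4 -Free G → NoK₄
  K₄-Free⇒NoK₄ free {a} {b} {c} {d} ab ac ad bc bd cd =
    free (induced (K 4) G f twinFree (λ v → any? λ i → f i ≟ v) agrees)
    where
    f : Fin 4 → Fin n
    f 0F = a
    f 1F = b
    f 2F = c
    f 3F = d

    twinFree : TwinFree (K 4)
    twinFree = toWitness {a? = all? λ i → all? λ j →
      (all? λ k → does (adj? (K 4) i k) Bool.≟ does (adj? (K 4) j k)) →-dec (i ≟ j)} _

    adjacent : ∀ {u v} → u ~ v → true ≡ does (u ~? v)
    adjacent u~v = sym (dec-true (_ ~? _) u~v)

    loop : ∀ {u} → false ≡ does (u ~? u)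
    loop = sym (dec-false (_ ~? _) ~-irrefl)

    agrees : ∀ i j → does (adj? (K 4) i j) ≡ does (f i ~? f j)
    agrees 0F 0F = loop
    agrees 0F 1F = adjacent ab
    agrees 0F 2F = adjacent ac
    agrees 0F 3F = adjacent ad
    agrees 1F 0F = adjacent (~-sym ab)
    agrees 1F 1F = loop
    agrees 1F 2F = adjacent bc
    agrees 1F 3F = adjacent bd
    agrees 2F 0F = adjacent (~-sym ac)
    agrees 2F 1F = adjacent (~-sym bc)
    agrees 2F 2F = loop
    agrees 2F 3F = adjacent cd
    agrees 3F 0F = adjacent (~-sym ad)
    agrees 3F 1F = adjacent (~-sym bd)
    agrees 3F 2F = adjacent (~-sym cd)
    agrees 3F 3F = loop

  co-gem-Free⇒NoCoGem : co-gem -Free G → NoCoGem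
  co-gem-Free⇒NoCoGem free {a} {b} {c} {d} {e} (path ab bc cd a≁c a≁d b≁d) e≁a e≁b e≁c e≁d =
    free (induced co-gem G f twinFree image? agrees)
    where
    f : Fin 4 ⊎ Fin 1 → Fin n
    f (inj₁ 0F) = a
    f (inj₁ 1F) = b
    f (inj₁ 2F) = c
    f (inj₁ 3F) = d
    f (inj₂ 0F) = e

    both? : {A : Fin 4 ⊎ Fin 1 → Set} → (∀ w → Dec (A w)) → Dec (∀ w → A w)
    both? A? = map′ (λ (l , r) → λ { (inj₁ i) → l i ; (inj₂ i) → r i })
                    (λ h → h ∘ inj₁ , h ∘ inj₂)
                    (all? (A? ∘ inj₁) ×-dec all? (A? ∘ inj₂))

    twinFree : TwinFree co-gem
    twinFree = toWitness {a? = both? λ w → both? λ w′ →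
      (both? λ x → does (adj? co-gem w x) Bool.≟ does (adj? co-gem w′ x)) →-dec ≡-dec _≟_ _≟_ w w′} _

    image? : ∀ v → Dec (∃[ w ] f w ≡ v)
    image? v = map′ (λ { (inj₁ (i , eq)) → inj₁ i , eq ; (inj₂ (i , eq)) → inj₂ i , eq })
                    (λ { (inj₁ i , eq) → inj₁ (i , eq) ; (inj₂ i , eq) → inj₂ (i , eq) })
                    (any? (λ i → f (inj₁ i) ≟ v) ⊎-dec any? (λ i → f (inj₂ i) ≟ v))

    adjacent : ∀ {u v} → u ~ v → true ≡ does (u ~? v)
    adjacent u~v = sym (dec-true (_ ~? _) u~v)

    nonadjacent : ∀ {u v} → u ≁ v → false ≡ does (u ~? v)
    nonadjacent u≁v = sym (dec-false (_ ~? _) u≁v)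

    agrees : ∀ w w′ → does (adj? co-gem w w′) ≡ does (f w ~? f w′)
    agrees (inj₁ 0F) (inj₁ 0F) = nonadjacent ~-irrefl
    agrees (inj₁ 0F) (inj₁ 1F) = adjacent ab
    agrees (inj₁ 0F) (inj₁ 2F) = nonadjacent a≁c
    agrees (inj₁ 0F) (inj₁ 3F) = nonadjacent a≁d
    agrees (inj₁ 0F) (inj₂ 0F) = nonadjacent (≁-sym e≁a)
    agrees (inj₁ 1F) (inj₁ 0F) = adjacent (~-sym ab)
    agrees (inj₁ 1F) (inj₁ 1F) = nonadjacent ~-irrefl
    agrees (inj₁ 1F) (inj₁ 2F) = adjacent bc
    agrees (inj₁ 1F) (inj₁ 3F) = nonadjacent b≁d
    agrees (inj₁ 1F) (inj₂ 0F) = nonadjacent (≁-sym e≁b)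
    agrees (inj₁ 2F) (inj₁ 0F) = nonadjacent (≁-sym a≁c)
    agrees (inj₁ 2F) (inj₁ 1F) = adjacent (~-sym bc)
    agrees (inj₁ 2F) (inj₁ 2F) = nonadjacent ~-irrefl
    agrees (inj₁ 2F) (inj₁ 3F) = adjacent cd
    agrees (inj₁ 2F) (inj₂ 0F) = nonadjacent (≁-sym e≁c)
    agrees (inj₁ 3F) (inj₁ 0F) = nonadjacent (≁-sym a≁d)
    agrees (inj₁ 3F) (inj₁ 1F) = nonadjacent (≁-sym b≁d)
    agrees (inj₁ 3F) (inj₁ 2F) = adjacent (~-sym cd)
    agrees (inj₁ 3F) (inj₁ 3F) = nonadjacent ~-irrefl
    agrees (inj₁ 3F) (inj₂ 0F) = nonadjacent (≁-sym e≁d)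
    agrees (inj₂ 0F) (inj₁ 0F) = nonadjacent e≁a
    agrees (inj₂ 0F) (inj₁ 1F) = nonadjacent e≁b
    agrees (inj₂ 0F) (inj₁ 2F) = nonadjacent e≁c
    agrees (inj₂ 0F) (inj₁ 3F) = nonadjacent e≁d
    agrees (inj₂ 0F) (inj₂ 0F) = nonadjacent ~-irrefl

-- Colourings of vertex sets; first-fit on P₄-free sets

module Colouring {n : ℕ} (G : Graph (Fin n)) where
  open Adjacency G

  VertexSet : Set₁
  VertexSet = Pred (Fin n) 0ℓ

  private variable
    S T′ : VertexSet
    j k  : ℕ

  ProperOn : VertexSet → (Fin n → Fin k) → Set
  ProperOn S c = ∀ {u v} → S u → S v → u ~ v → c u ≢ c v

  ColourableOn : ℕ → VertexSet → Set
  ColourableOn k S = Σ[ c ∈ (Fin n → Fin k) ] ProperOn S c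

  Independent : VertexSet → Set
  Independent S = ∀ {u v} → S u → S v → u ≁ v

  independent⇒1-colourable : Independent S → ColourableOn 1 S
  independent⇒1-colourable ind = (λ _ → 0F) , λ Su Sv u~v _ → ind Su Sv u~v

  ∪-colourable : Decidable S → ColourableOn j S → ColourableOn k T′ → ColourableOn (j ℕ.+ k) (S ∪ T′)
  ∪-colourable {S} {j} {k} {T′} S? (c₁ , proper₁) (c₂ , proper₂) = c , proper
    where
    c : Fin n → Fin (j ℕ.+ k)
    c v = if does (S? v) then c₁ v ↑ˡ k else j ↑ʳ c₂ v

    ↑ˡ≢↑ʳ : ∀ {j k} (x : Fin j) (y : Fin k) → x ↑ˡ k ≢ j ↑ʳ y
    ↑ˡ≢↑ʳ {suc j} (suc x) y eq = ↑ˡ≢↑ʳ x y (Fin.suc-injective eq)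

    inT : ∀ {v} → ¬ S v → (S ∪ T′) v → T′ v
    inT ¬Sv (inj₁ Sv) = contradiction Sv ¬Sv
    inT ¬Sv (inj₂ Tv) = Tv

    proper : ProperOn (S ∪ T′) c
    proper {u} {v} u∈ v∈ u~v eq with S? u | S? v
    ... | yes Su | yes Sv = proper₁ Su Sv u~v (Fin.↑ˡ-injective k _ _ eq)
    ... | yes _  | no _   = ↑ˡ≢↑ʳ (c₁ u) (c₂ v) eq
    ... | no _   | yes _  = ↑ˡ≢↑ʳ (c₁ v) (c₂ u) (sym eq)
    ... | no ¬Su | no ¬Sv = proper₂ (inT ¬Su u∈) (inT ¬Sv v∈) u~v (Fin.↑ʳ-injective j _ _ eq)

  colourable : ColourableOn k S → (∀ v → S v) → Colourable k G
  colourable (c , proper) all = c , λ u v → proper (all u) (all v)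

  P₄-FreeOn : VertexSet → Set
  P₄-FreeOn S = ∀ {a b c d} → S a → S b → S c → S d → ¬ P₄ a b c d

  TriangleFreeOn : VertexSet → Set
  TriangleFreeOn S = ∀ {a b c} → S a → S b → S c → a ~ b → a ~ c → b ~ c → ⊥

  -- These are the Grundy colourings, the possible outcomes of first-fit. Three colours are enough,
  -- as K₄ is excluded wherever such a colouring is built.
  FirstFit : VertexSet → (Fin n → Fin 3) → Set
  FirstFit S c = ProperOn S c ×
    (∀ {u} {i : Fin 3} → S u → i Fin.< c u → ∃[ w ] S w × u ~ w × c w ≡ i)

  private
    <-resp : {i k l : Fin 3} → l ≡ k → i Fin.< k → i Fin.< l
    <-resp refl i<k = i<k

  module _ {S X : VertexSet} (P₄-free : P₄-FreeOn S) (X⊆S : X ⊆ S)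
           {c : Fin n → Fin 3} (proper : ProperOn X c) where

    -- Having one colour, x and y are nonadjacent. If also x missed q and y missed p, then x - p - q
    -- - y would be a P₄ in S; so x or y serves as z.
    commonNeighbour : ∀ {p q x y} → S p → S q → X x → X y → p ~ q → p ~ x → q ~ y → c x ≡ c y →
                      ∃[ z ] X z × p ~ z × q ~ z × c z ≡ c x
    commonNeighbour {p} {q} {x} {y} Sp Sq Xx Xy pq px qy cx≡cy with q ~? x | p ~? y
    ... | yes qx | _      = x , Xx , px , qx , refl
    ... | no _   | yes py = y , Xy , py , qy , sym cx≡cy
    ... | no q≁x | no p≁y = contradiction
      (path (~-sym px) pq qy (≁-sym q≁x) (λ xy → proper Xx Xy xy cx≡cy) p≁y)
      (P₄-free (X⊆S Xx) Sp Sq (X⊆S Xy))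

    -- Let w be the common neighbour of p and q. If r misses w, then z serves instead: were z
    -- nonadjacent to s, one of p and q, then w - s - r - z would be a P₄.
    commonNeighbour₃ : ∀ {p q r x y z} → S p → S q → S r → X x → X y → X z →
      p ~ q → p ~ r → q ~ r → p ~ x → q ~ y → r ~ z → c x ≡ c y → c x ≡ c z →
      ∃[ w ] p ~ w × q ~ w × r ~ w
    commonNeighbour₃ {p} {q} {r} {z = z} Sp Sq Sr Xx Xy Xz pq pr qr px qy rz cx≡cy cx≡cz
      with w , Xw , pw , qw , cw ← commonNeighbour Sp Sq Xx Xy pq px qy cx≡cy
      with r ~? w
    ... | yes rw = w , pw , qw , rw
    ... | no r≁w = z , via Sp pr pw , via Sq qr qw , rz
      where
      via : ∀ {s} → S s → s ~ r → s ~ w → s ~ z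
      via {s} Ss sr sw = decidable-stable (s ~? z) λ s≁z →
        P₄-free (X⊆S Xw) Ss Sr (X⊆S Xz) (path (~-sym sw) sr rz (≁-sym r≁w)
          (λ wz → proper Xw Xz wz (trans cw cx≡cz)) s≁z)

  -- First-fit gives u a neighbour x of colour 1, and gives u and x neighbours of colour 0;
  -- `commonNeighbour` makes the latter a shared one.
  triangleAt : ∀ {c u} → P₄-FreeOn S → FirstFit S c → S u → c u ≡ 2F →
    ∃[ x ] ∃[ y ] S x × S y × u ~ x × u ~ y × x ~ y
  triangleAt P₄-free (proper , below) Su cu≡2
    with x , Sx , ux , cx ← below {i = 1F} Su (<-resp cu≡2 (s≤s (s≤s z≤n)))
       | y , Sy , uy , cy ← below {i = 0F} Su (<-resp cu≡2 (s≤s z≤n))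
    with z , Sz , xz , cz ← below {i = 0F} Sx (<-resp cx (s≤s z≤n))
    with w , Sw , uw , xw , _ ← commonNeighbour P₄-free id proper Su Sx Sy Sz ux uy xz (trans cy (sym cz))
    = x , w , Sx , Sw , ux , uw , xw

  module _ (noK₄ : NoK₄) where

    -- Otherwise h and a neighbour u of colour 2 share a neighbour z of colour 1, and h, u, z share
    -- a further neighbour w, which makes a K₄. Hence first-fit never runs out of its three colours.
    missingColour : ∀ {S X c h} → P₄-FreeOn S → X ⊆ S → FirstFit X c → S h →
      ¬ (∀ i → ∃[ w ] X w × h ~ w × c w ≡ i)
    missingColour P₄-free X⊆S (proper , below) Sh neighbour
      with u , Xu , hu , cu ← neighbour 2F
         | x , Xx , hx , cx ← neighbour 1F
         | y , Xy , hy , cy ← neighbour 0F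
      with x′ , Xx′ , ux′ , cx′ ← below {i = 1F} Xu (<-resp cu (s≤s (s≤s z≤n)))
         | y′ , Xy′ , uy′ , cy′ ← below {i = 0F} Xu (<-resp cu (s≤s z≤n))
      with z , Xz , hz , uz , cz ←
             commonNeighbour P₄-free X⊆S proper Sh (X⊆S Xu) Xx Xx′ hu hx ux′ (trans cx (sym cx′))
      with y″ , Xy″ , zy″ , cy″ ← below {i = 0F} Xz (<-resp (trans cz cx) (s≤s z≤n))
      with w , hw , uw , zw ←
             commonNeighbour₃ P₄-free X⊆S proper Sh (X⊆S Xu) (X⊆S Xz) Xy Xy′ Xy″ hu hz uz hy uy′ zy″
               (trans cy (sym cy′)) (trans cy (sym cy″))
      = noK₄ hu hz hw uz uw zw

    private
      insert : ∀ {xs c} (h : Fin n) (k : Fin 3) → h List.∉ xs → FirstFit (List._∈ xs) c →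
        (∀ {w} → w List.∈ xs → h ~ w → c w ≢ k) →
        (∀ {i} → i Fin.< k → ∃[ w ] w List.∈ xs × h ~ w × c w ≡ i) →
        ∃[ c′ ] FirstFit (List._∈ h ∷ xs) c′
      insert {xs} {c} h k h∉xs (proper , below) missing present = c′ , proper′ , below′
        where
        c′ : Fin n → Fin 3
        c′ v = if does (v ≟ h) then k else c v

        c′-h : c′ h ≡ k
        c′-h rewrite dec-true (h ≟ h) refl = refl

        c′-xs : ∀ {v} → v List.∈ xs → c′ v ≡ c v
        c′-xs {v} v∈xs rewrite dec-false (v ≟ h) (λ { refl → h∉xs v∈xs }) = refl

        proper′ : ProperOn (List._∈ h ∷ xs) c′
        proper′ (here refl) (here refl) h~h _ = ~-irrefl h~h
        proper′ (here refl) (there v∈) h~v eq =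
          missing v∈ h~v (trans (sym (c′-xs v∈)) (trans (sym eq) c′-h))
        proper′ (there u∈) (here refl) u~h eq =
          missing u∈ (~-sym u~h) (trans (sym (c′-xs u∈)) (trans eq c′-h))
        proper′ (there u∈) (there v∈) u~v eq =
          proper u∈ v∈ u~v (trans (sym (c′-xs u∈)) (trans eq (c′-xs v∈)))

        below′ : ∀ {u} {i : Fin 3} → u List.∈ h ∷ xs → i Fin.< c′ u →
                 ∃[ w ] w List.∈ h ∷ xs × u ~ w × c′ w ≡ i
        below′ (here refl) i< with w , w∈ , hw , cw ← present (<-resp (sym c′-h) i<)
          = w , there w∈ , hw , trans (c′-xs w∈) cw
        below′ (there u∈) i< with w , w∈ , uw , cw ← below u∈ (<-resp (sym (c′-xs u∈)) i<)
          = w , there w∈ , uw , trans (c′-xs w∈) cw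

    firstFit-list : P₄-FreeOn S → ∀ xs → All S xs → ∃[ c ] FirstFit (List._∈ xs) c
    firstFit-list P₄-free [] [] = (λ _ → 0F) , (λ ()) , λ ()
    firstFit-list {S} P₄-free (h ∷ xs) (Sh ∷ Sxs)
      with c , fit@(proper , below) ← firstFit-list P₄-free xs Sxs
      with h ∈? xs
      where open DecMembership _≟_ using (_∈?_)
    ... | yes h∈xs = c , (λ u∈ v∈ → proper (old u∈) (old v∈)) , λ u∈ i< →
      let w , w∈ , uw , cw = below (old u∈) i< in w , there w∈ , uw , cw
      where
      old : ∀ {v} → v List.∈ h ∷ xs → v List.∈ xs
      old (here refl) = h∈xs
      old (there v∈)  = v∈
    ... | no h∉xs with neighbour? 0F | neighbour? 1F | neighbour? 2F
      where
      open DecMembership _≟_ using (_∈?_)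
      neighbour? : ∀ i → Dec (∃[ w ] w List.∈ xs × h ~ w × c w ≡ i)
      neighbour? i = any? λ w → w ∈? xs ×-dec h ~? w ×-dec c w ≟ i
    ... | no none | _ | _ = insert h 0F h∉xs fit (λ w∈ hw cw → none (_ , w∈ , hw , cw)) λ ()
    ... | yes n₀ | no none | _ =
      insert h 1F h∉xs fit (λ w∈ hw cw → none (_ , w∈ , hw , cw)) λ { {0F} _ → n₀ ; {suc _} (s≤s ()) }
    ... | yes n₀ | yes n₁ | no none =
      insert h 2F h∉xs fit (λ w∈ hw cw → none (_ , w∈ , hw , cw))
        λ { {0F} _ → n₀ ; {1F} _ → n₁ ; {2F} (s≤s (s≤s ())) }
    ... | yes n₀ | yes n₁ | yes n₂ = ⊥-elim (missingColour P₄-free (All.lookup Sxs) fit Sh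
      λ { 0F → n₀ ; 1F → n₁ ; 2F → n₂ })

    firstFit : Decidable S → P₄-FreeOn S → ∃[ c ] FirstFit S c
    firstFit {S} S? P₄-free
      with c , proper , below ← firstFit-list P₄-free (filter S? (allFin n)) (all-filter S? (allFin n))
      = c , (λ Su Sv → proper (member Su) (member Sv)) , λ Su i< →
        let w , w∈ , uw , cw = below (member Su) i< in w , proj₂ (∈-filter⁻ S? {xs = allFin n} w∈) , uw , cw
      where
      member : ∀ {v} → S v → v List.∈ filter S? (allFin n)
      member {v} = ∈-filter⁺ S? (∈-allFin v)

    P₄-free⇒3-colourable : Decidable S → P₄-FreeOn S → ColourableOn 3 S
    P₄-free⇒3-colourable S? P₄-free = let c , proper , _ = firstFit S? P₄-free in c , proper

    -- By `triangleAt` first-fit never uses colour 2 on S, so `fold` identifies no two colours in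
    -- use.
    P₄-free∧triangle-free⇒2-colourable : Decidable S → P₄-FreeOn S → TriangleFreeOn S → ColourableOn 2 S
    P₄-free∧triangle-free⇒2-colourable {S} S? P₄-free triangle-free
      with c , fit@(proper , _) ← firstFit S? P₄-free
      = (λ v → fold (c v)) , λ Su Sv u~v eq → proper Su Sv u~v (fold-injective (≢2 Su) (≢2 Sv) eq)
      where
      fold : Fin 3 → Fin 2
      fold 0F = 0F
      fold _  = 1F

      fold-injective : ∀ {i j} → i ≢ 2F → j ≢ 2F → fold i ≡ fold j → i ≡ j
      fold-injective {0F} {0F} _ _ _ = refl
      fold-injective {1F} {1F} _ _ _ = refl
      fold-injective {2F} i≢2 _ _ = contradiction refl i≢2
      fold-injective {_} {2F} _ j≢2 _ = contradiction refl j≢2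

      ≢2 : ∀ {u} → S u → c u ≢ 2F
      ≢2 Su cu≡2 = let _ , _ , Sx , Sy , ux , uy , xy = triangleAt P₄-free fit Su cu≡2
                   in triangle-free Su Sx Sy ux uy xy

    -- The neighbourhood of a vertex is independent, and the rest is P₄-free.
    triangle-free⇒3-colourable : NoCoGem → Decidable S → TriangleFreeOn S → ColourableOn 3 S
    triangle-free⇒3-colourable {S} noCoGem S? triangle-free with any? S?
    ... | no empty = (λ _ → 0F) , λ Su → contradiction (_ , Su) empty
    ... | yes (v , Sv) = let c , proper = ∪-colourable N? near far in
          c , λ Su Sw → proper (split Su) (split Sw)
      where
      N? : Decidable (λ u → S u × v ~ u)
      N? u = S? u ×-dec v ~? u

      near : ColourableOn 1 (λ u → S u × v ~ u)
      near = independent⇒1-colourable λ (Sx , vx) (Sy , vy) → triangle-free Sv Sx Sy vx vy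

      far : ColourableOn 2 (λ u → S u × v ≁ u)
      far = P₄-free∧triangle-free⇒2-colourable (λ u → S? u ×-dec ¬? (v ~? u))
        (λ (_ , a) (_ , b) (_ , c) (_ , d) p → noCoGem p a b c d)
        (λ (Sa , _) (Sb , _) (Sc , _) → triangle-free Sa Sb Sc)

      split : ∀ {u} → S u → (S u × v ~ u) ⊎ (S u × v ≁ u)
      split {u} Su with v ~? u
      ... | yes vu = inj₁ (Su , vu)
      ... | no v≁u = inj₂ (Su , v≁u)

-- Merging two nonadjacent vertices

module Merging {m : ℕ} (G : Graph (Fin (suc m))) where
  open Adjacency G

  -- Both conditions concern a neighbour c of u that is not a neighbour of v, that is, the other end
  -- of a new edge at v. `apex` prevents new co-gems and `noTriangle` prevents new K₄s.
  module Merge (noCoGem : NoCoGem) (noK₄ : NoK₄) (u v : Fin (suc m)) (u≢v : u ≢ v) (u≁v : u ≁ v)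
    (apex : ∀ {c x} → u ~ c → v ≁ c → x ≢ v → x ≁ u → x ≁ v → c ~ x)
    (noTriangle : ∀ {c y z} → u ~ c → v ≁ c → c ~ y → c ~ z → y ~ z → u ~ y ⊎ v ~ y → u ~ z ⊎ v ~ z → ⊥)
    where

    infix 4 _≈_
    -- Adjacency after u is identified with v, stated on all vertices of G; `merged` restricts it to
    -- those other than u.
    _≈_ : Fin (suc m) → Fin (suc m) → Set
    x ≈ y = x ~ y ⊎ (x ≡ v × u ~ y) ⊎ (y ≡ v × u ~ x)

    ≈-sym : ∀ {x y} → x ≈ y → y ≈ x
    ≈-sym (inj₁ xy)        = inj₁ (~-sym xy)
    ≈-sym (inj₂ (inj₁ p)) = inj₂ (inj₂ p)
    ≈-sym (inj₂ (inj₂ p)) = inj₂ (inj₁ p)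

    ≈-irrefl : ∀ {x} → ¬ x ≈ x
    ≈-irrefl (inj₁ xx)                   = ~-irrefl xx
    ≈-irrefl (inj₂ (inj₁ (refl , uv))) = u≁v uv
    ≈-irrefl (inj₂ (inj₂ (refl , uv))) = u≁v uv

    merged : Graph (Fin m)
    merged = record
      { Adj    = λ i j → punchIn u i ≈ punchIn u j
      ; symm   = ≈-sym
      ; irrefl = λ { refl → ≈-irrefl }
      ; adj?   = λ i j → let x = punchIn u i; y = punchIn u j in
                 x ~? y ⊎-dec (x ≟ v ×-dec u ~? y) ⊎-dec (y ≟ v ×-dec u ~? x)
      }

    private
      -- A new edge joins v to some y with u ~ y and v ≁ y. A vertex e that misses v after merging
      -- misses both u and v in G, so `apex` makes it adjacent to y. Every edge of a co-gem is
      -- missed by its isolated vertex, so none of them is new.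
      real : ∀ {x y e} → x ≈ y → ¬ e ≈ x → ¬ e ≈ y → x ~ y
      real (inj₁ xy) _ _ = xy
      real {y = y} {e} (inj₂ (inj₁ (refl , uy))) e≉v e≉y with v ~? y
      ... | yes vy = vy
      ... | no v≁y = contradiction (inj₁ (~-sym (apex uy v≁y e≢v e≁u (e≉v ∘ inj₁)))) e≉y
        where
        e≢v : e ≢ v
        e≢v refl = e≉y (inj₂ (inj₁ (refl , uy)))
        e≁u : e ≁ u
        e≁u eu = e≉v (inj₂ (inj₂ (refl , ~-sym eu)))
      real (inj₂ (inj₂ (refl , ux))) e≉x e≉v = ~-sym (real (inj₂ (inj₁ (refl , ux))) e≉v e≉x)

      v≈⇒ : ∀ {x} → v ≈ x → u ~ x ⊎ v ~ x
      v≈⇒ (inj₁ vx)                   = inj₂ vx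
      v≈⇒ (inj₂ (inj₁ (_ , ux)))    = inj₁ ux
      v≈⇒ (inj₂ (inj₂ (_ , uv)))    = contradiction uv u≁v

      away : ∀ {x y} → v ≈ x → v ≈ y → x ≈ y → x ~ y
      away _  _  (inj₁ xy)                 = xy
      away vv _  (inj₂ (inj₁ (refl , _))) = contradiction vv ≈-irrefl
      away _  vv (inj₂ (inj₂ (refl , _))) = contradiction vv ≈-irrefl

      -- If b, c, d are all neighbours of v in G, this is a K₄ of G. Otherwise one of them is
      -- adjacent to u only, and `noTriangle` applies to it.
      noK₄-at-v : ∀ {b c d} → v ≈ b → v ≈ c → v ≈ d → b ≈ c → b ≈ d → c ≈ d → ⊥
      noK₄-at-v {b} {c} {d} vb vc vd bc bd cd with v ~? b | v ~? c | v ~? d | v≈⇒ vb | v≈⇒ vc | v≈⇒ vd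
      ... | yes v~b | yes v~c | yes v~d | _ | _ | _ =
        noK₄ v~b v~c v~d (away vb vc bc) (away vb vd bd) (away vc vd cd)
      ... | no v≁b | _ | _ | inj₁ ub | c∈ | d∈ =
        noTriangle ub v≁b (away vb vc bc) (away vb vd bd) (away vc vd cd) c∈ d∈
      ... | no v≁b | _ | _ | inj₂ v~b | _ | _ = v≁b v~b
      ... | yes _ | no v≁c | _ | b∈ | inj₁ uc | d∈ =
        noTriangle uc v≁c (~-sym (away vb vc bc)) (away vc vd cd) (away vb vd bd) b∈ d∈
      ... | yes _ | no v≁c | _ | _ | inj₂ v~c | _ = v≁c v~c
      ... | yes _ | yes _ | no v≁d | b∈ | c∈ | inj₁ ud =
        noTriangle ud v≁d (~-sym (away vb vd bd)) (~-sym (away vc vd cd)) (away vb vc bc) b∈ c∈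
      ... | yes _ | yes _ | no v≁d | _ | _ | inj₂ v~d = v≁d v~d

    merged-noCoGem : Adjacency.NoCoGem merged
    merged-noCoGem (Adjacency.path ab bc cd a≉c a≉d b≉d) e≉a e≉b e≉c e≉d =
      noCoGem (path (real ab e≉a e≉b) (real bc e≉b e≉c) (real cd e≉c e≉d)
                    (a≉c ∘ inj₁) (a≉d ∘ inj₁) (b≉d ∘ inj₁))
              (e≉a ∘ inj₁) (e≉b ∘ inj₁) (e≉c ∘ inj₁) (e≉d ∘ inj₁)

    merged-noK₄ : Adjacency.NoK₄ merged
    merged-noK₄ ab ac ad bc bd cd = go ab ac ad bc bd cd
      where
      go : ∀ {a b c d} → a ≈ b → a ≈ c → a ≈ d → b ≈ c → b ≈ d → c ≈ d → ⊥
      go {a} {b} {c} {d} ab ac ad bc bd cd with a ≟ v | b ≟ v | c ≟ v | d ≟ v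
      ... | yes refl | _ | _ | _ = noK₄-at-v ab ac ad bc bd cd
      ... | no _ | yes refl | _ | _ = noK₄-at-v (≈-sym ab) bc bd ac ad cd
      ... | no _ | no _ | yes refl | _ = noK₄-at-v (≈-sym ac) (≈-sym bc) cd ab ad bd
      ... | no _ | no _ | no _ | yes refl = noK₄-at-v (≈-sym ad) (≈-sym bd) (≈-sym cd) ab ac bc
      ... | no a≢v | no b≢v | no c≢v | no d≢v =
        noK₄ (off a≢v b≢v ab) (off a≢v c≢v ac) (off a≢v d≢v ad)
             (off b≢v c≢v bc) (off b≢v d≢v bd) (off c≢v d≢v cd)
        where
        off : ∀ {x y} → x ≢ v → y ≢ v → x ≈ y → x ~ y
        off _ _ (inj₁ xy) = xy
        off x≢v _ (inj₂ (inj₁ (x≡v , _))) = contradiction x≡v x≢v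
        off _ y≢v (inj₂ (inj₂ (y≡v , _))) = contradiction y≡v y≢v

    unmerge : ∀ {k} → Colourable k merged → Colourable k G
    unmerge {k} (c , proper) = (λ x → c (down x)) , λ x y x~y → proper (down x) (down y) (adjacent x y x~y)
      where
      down : Fin (suc m) → Fin m
      down x with u ≟ x
      ... | yes _  = punchOut u≢v
      ... | no u≢x = punchOut u≢x

      adjacent : ∀ x y → x ~ y → Adj merged (down x) (down y)
      adjacent x y xy with u ≟ x | u ≟ y
      ... | yes refl | yes refl = contradiction xy ~-irrefl
      ... | yes refl | no u≢y
        rewrite Fin.punchIn-punchOut u≢v | Fin.punchIn-punchOut u≢y = inj₂ (inj₁ (refl , xy))
      ... | no u≢x | yes refl
        rewrite Fin.punchIn-punchOut u≢v | Fin.punchIn-punchOut u≢x = inj₂ (inj₂ (refl , ~-sym xy))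
      ... | no u≢x | no u≢y
        rewrite Fin.punchIn-punchOut u≢x | Fin.punchIn-punchOut u≢y = inj₁ xy

-- The exhaustive search

Row : Set
Row = List Bool

-- Row i of a matrix lists the adjacencies of vertex i to the later vertices.
Matrix : Set
Matrix = List Row

-- Here xw is the adjacency of x and w, and so on.  A graph on four vertices is forbidden if it is
-- complete or has at most one edge, that is, K₄, 4K₁ and the co-diamond K₂ + 2K₁.
forbidden : Bool → Bool → Bool → Bool → Bool → Bool → Bool
forbidden xw xi xj wi wj ij =
  (xw ∧ xi ∧ xj ∧ wi ∧ wj ∧ ij)
    ∨ none xi xj wi wj ij ∨ none xw xj wi wj ij ∨ none xw xi wi wj ij
    ∨ none xw xi xj wj ij ∨ none xw xi xj wi ij ∨ none xw xi xj wi wj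
  where
  none : Bool → Bool → Bool → Bool → Bool → Bool
  none a b c d e = not a ∧ not b ∧ not c ∧ not d ∧ not e

admissibleWith : Bool → Bool → Bool → Row → Row → Row → Bool
admissibleWith xw xi wi (xj ∷ x) (wj ∷ w) (ij ∷ i) =
  not (forbidden xw xi xj wi wj ij) ∧ admissibleWith xw xi wi x w i
admissibleWith _ _ _ _ _ _ = true

-- The quadruples tested contain x and the newest vertex w. Those formed by x and three older
-- vertices were tested when the newest of the three entered the matrix.
admissible : Bool → Row → Row → Matrix → Bool
admissible xw (xi ∷ x) (wi ∷ w) (i ∷ F) = admissibleWith xw xi wi x w i ∧ admissible xw x w F
admissible _ _ _ _ = true

extend : Matrix → Row → List Row → List Row
extend F w []       = []
extend F w (x ∷ xs) = keep true (keep false (extend F w xs))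
  where
  keep : Bool → List Row → List Row
  keep b rest = if admissible b x w F then (b ∷ x) ∷ rest else rest

compatible : Fin 4 → Row → List (Fin 4) → Bool
compatible k (true  ∷ x) (l ∷ c) = not (does (k ≟ l)) ∧ compatible k x c
compatible k (false ∷ x) (l ∷ c) = compatible k x c
compatible k _ _ = true

colourings : Matrix → List (List (Fin 4))
colourings []      = [] ∷ []
colourings (x ∷ F) =
  concatMap (λ c → map (_∷ c) (filterᵇ (λ k → compatible k x c) (0F ∷ 1F ∷ 2F ∷ 3F ∷ []))) (colourings F)

-- The candidates are the possible rows of the vertices outside the matrix.  Either some vertex
-- realises the first one, and it is added to the matrix, or that candidate is dropped; without
-- candidates the matrix is the whole graph.
search : ℕ → Matrix → List Row → Bool
search zero    F _        = false
search (suc k) F []       = not (null (colourings F))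
search (suc k) F (w ∷ ws) = search k (w ∷ F) (extend F w (w ∷ ws)) ∧ search k F ws

-- Soundness of the search

module Search {n : ℕ} (G : Graph (Fin n)) where
  open Adjacency G
  open Colouring G
  open DecMembership (_≟_ {n}) using (_∈?_)

  e : Fin n → Fin n → Bool
  e x y = does (x ~? y)

  data Realises : Matrix → List (Fin n) → Set where
    []  : Realises [] []
    _∷_ : ∀ {x F vs} → x List.∉ vs → Realises F vs → Realises (map (e x) vs ∷ F) (x ∷ vs)

  Unforbidden : Set
  Unforbidden = ∀ {x w i j} → x ≢ w → x ≢ i → x ≢ j → w ≢ i → w ≢ j → i ≢ j →
                ¬ T (forbidden (e x w) (e x i) (e x j) (e w i) (e w j) (e i j))

  private
    not-T : ∀ {b} → ¬ T b → T (not b)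
    not-T {false} _ = _
    not-T {true}  h = h _

    ∧-intro : ∀ {a b} → T a → T b → T (a ∧ b)
    ∧-intro {true} _ b = b

    ∧-elim : ∀ {a b} → T (a ∧ b) → T a × T b
    ∧-elim {true} b = _ , b

  colourings-sound : ∀ {F vs cs} → Realises F vs → cs List.∈ colourings F →
                     ∃[ c ] map c vs ≡ cs × ProperOn (List._∈ vs) c
  colourings-sound [] (here refl) = (λ _ → 0F) , refl , λ ()
  colourings-sound {vs = x ∷ vs} (_∷_ {F = F} x∉vs real) cs∈
    with cs₀ , cs₀∈ , cs∈′ ← find (∈-concatMap⁻ _ {xs = colourings F} cs∈)
    with k , k∈ , refl ← ∈-map⁻ (_∷ cs₀) cs∈′
    with c , refl , proper ← colourings-sound real cs₀∈
    = c′ , cong₂ _∷_ c′-x (map-c′ vs id) , proper′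
    where
    compat : T (compatible k (map (e x) vs) (map c vs))
    compat = proj₂ (∈-filter⁻ (T? ∘ (λ k → compatible k (map (e x) vs) (map c vs)))
                     {xs = 0F ∷ 1F ∷ 2F ∷ 3F ∷ []} k∈)

    c′ : Fin n → Fin 4
    c′ v = if does (v ≟ x) then k else c v

    c′-x : c′ x ≡ k
    c′-x rewrite dec-true (x ≟ x) refl = refl

    c′-vs : ∀ {v} → v List.∈ vs → c′ v ≡ c v
    c′-vs {v} v∈vs rewrite dec-false (v ≟ x) (λ { refl → x∉vs v∈vs }) = refl

    map-c′ : ∀ ys → (∀ {v} → v List.∈ ys → v List.∈ vs) → map c′ ys ≡ map c ys
    map-c′ []       _  = refl
    map-c′ (y ∷ ys) in-vs = cong₂ _∷_ (c′-vs (in-vs (here refl))) (map-c′ ys (in-vs ∘ there))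

    compatible-sound : ∀ ys → T (compatible k (map (e x) ys) (map c ys)) →
                       ∀ {v} → v List.∈ ys → x ~ v → k ≢ c v
    compatible-sound (y ∷ ys) t v∈ xv eq with x ~? y | v∈
    ... | yes _ | here refl with k ≟ c y
    ...   | no k≢ = k≢ eq
    compatible-sound (y ∷ ys) t v∈ xv eq | yes _ | there v∈′ =
      compatible-sound ys (proj₂ (∧-elim {not (does (k ≟ c y))} t)) v∈′ xv eq
    compatible-sound (y ∷ ys) t v∈ xv eq | no x≁y | here refl = x≁y xv
    compatible-sound (y ∷ ys) t v∈ xv eq | no _ | there v∈′ = compatible-sound ys t v∈′ xv eq

    proper′ : ProperOn (List._∈ x ∷ vs) c′
    proper′ (here refl) (here refl) xx _ = ~-irrefl xx
    proper′ (here refl) (there v∈) xv eq =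
      compatible-sound vs compat v∈ xv (trans (sym c′-x) (trans eq (c′-vs v∈)))
    proper′ (there u∈) (here refl) ux eq =
      compatible-sound vs compat u∈ (~-sym ux) (trans (sym c′-x) (trans (sym eq) (c′-vs u∈)))
    proper′ (there u∈) (there v∈) uv eq = proper u∈ v∈ uv (trans (sym (c′-vs u∈)) (trans eq (c′-vs v∈)))

  module _ (unforbidden : Unforbidden) where

    admissibleWith-complete : ∀ {x w i} ys → x ≢ w → x ≢ i → w ≢ i →
      x List.∉ ys → w List.∉ ys → i List.∉ ys →
      T (admissibleWith (e x w) (e x i) (e w i) (map (e x) ys) (map (e w) ys) (map (e i) ys))
    admissibleWith-complete [] _ _ _ _ _ _ = _
    admissibleWith-complete (j ∷ ys) x≢w x≢i w≢i x∉ w∉ i∉ = ∧-intro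
      (not-T (unforbidden x≢w x≢i (x∉ ∘ here) w≢i (w∉ ∘ here) (i∉ ∘ here)))
      (admissibleWith-complete ys x≢w x≢i w≢i (x∉ ∘ there) (w∉ ∘ there) (i∉ ∘ there))

    -- No quadruple of G is forbidden, so the row of an actual vertex passes every test; pruning
    -- discards only rows that no vertex has.
    admissible-complete : ∀ {F vs x w} → Realises F vs → x ≢ w → x List.∉ vs → w List.∉ vs →
                          T (admissible (e x w) (map (e x) vs) (map (e w) vs) F)
    admissible-complete [] _ _ _ = _
    admissible-complete (_∷_ {vs = vs} i∉vs real) x≢w x∉ w∉ = ∧-intro
      (admissibleWith-complete vs x≢w (x∉ ∘ here) (w∉ ∘ here) (x∉ ∘ there) (w∉ ∘ there) i∉vs)
      (admissible-complete real x≢w (x∉ ∘ there) (w∉ ∘ there))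

    extend-complete : ∀ {F x w b} ws → T (admissible b x w F) → x List.∈ ws → (b ∷ x) List.∈ extend F w ws
    extend-complete {F} {x} {w} {true} (x ∷ ws) ok (here refl) with admissible true x w F
    ... | true = here refl
    extend-complete {F} {x} {w} {false} (x ∷ ws) ok (here refl)
      with admissible true x w F | admissible false x w F
    ... | true  | true = there (here refl)
    ... | false | true = here refl
    extend-complete {F} {x} {w} (y ∷ ws) ok (there x∈)
      with admissible true y w F | admissible false y w F | extend-complete ws ok x∈
    ... | true  | true  | ∈ws = there (there ∈ws)
    ... | true  | false | ∈ws = there ∈ws
    ... | false | true  | ∈ws = there ∈ws
    ... | false | false | ∈ws = ∈ws

    -- The invariant `cover` says that each vertex is in the matrix or has its row among the
    -- candidates. After a vertex with row w is added, w stays a candidate, since other vertices may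
    -- have the same row.
    search-sound : ∀ k {F vs} ws → Realises F vs → (∀ x → x List.∈ vs ⊎ map (e x) vs List.∈ ws) →
                   T (search k F ws) → Colourable 4 G
    search-sound (suc k) {F} [] real cover found with colourings F in eq
    ... | cs ∷ _ with c , _ , proper ← colourings-sound real (subst (cs List.∈_) (sym eq) (here refl))
      = c , λ u v → proper (in-vs u) (in-vs v)
      where
      in-vs : ∀ x → x List.∈ _
      in-vs x with cover x
      ... | inj₁ x∈ = x∈
    search-sound (suc k) {F} {vs} (w ∷ ws) real cover found
      with any? (λ x → ¬? (x ∈? vs) ×-dec List.≡-dec Bool._≟_ (map (e x) vs) w)
         | ∧-elim {search k (w ∷ F) (extend F w (w ∷ ws))} found
    ... | yes (x , x∉ , refl) | found′ , _ = search-sound k _ (x∉ ∷ real) cover′ found′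
      where
      cover′ : ∀ y → y List.∈ x ∷ vs ⊎ map (e y) (x ∷ vs) List.∈ extend F w (w ∷ ws)
      cover′ y with y ∈? (x ∷ vs) | cover y
      ... | yes y∈ | _        = inj₁ y∈
      ... | no y∉  | inj₁ y∈ = contradiction (there y∈) y∉
      ... | no y∉  | inj₂ t∈ = inj₂ (extend-complete (w ∷ ws)
              (admissible-complete real (y∉ ∘ here) (y∉ ∘ there) x∉) t∈)
    ... | no none | _ , found′ = search-sound k ws real cover′ found′
      where
      cover′ : ∀ y → y List.∈ vs ⊎ map (e y) vs List.∈ ws
      cover′ y with cover y
      ... | inj₁ y∈         = inj₁ y∈
      ... | inj₂ (there t∈) = inj₂ t∈
      ... | inj₂ (here eq) with y ∈? vs
      ...   | yes y∈ = inj₁ y∈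
      ...   | no y∉ = contradiction (y , y∉ , eq) none

    search≡true⇒4-colourable : ∀ k {F vs} ws → Realises F vs →
      (∀ x → x List.∈ vs ⊎ map (e x) vs List.∈ ws) → search k F ws ≡ true → Colourable 4 G
    search≡true⇒4-colourable k ws real cover eq = search-sound k ws real cover (subst T (sym eq) _)

-- The search ends because a (K₄, 4K₁, co-diamond)-free graph has at most 10 vertices; 60 bounds the
-- number of steps on a branch.
search-succeeds : search 60 [] ([] ∷ []) ≡ true
search-succeeds = refl

-- Graphs without a co-diamond

module CoDiamondFree {n : ℕ} (G : Graph (Fin n)) where
  open Adjacency G
  open Colouring G

  module _ (noCoGem : NoCoGem) (noK₄ : NoK₄)
    (noCoDiamond : ∀ {a b c d} → a ~ b → c ≢ d → c ≁ a → c ≁ b → d ≁ a → d ≁ b → c ≁ d → ⊥)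
    where

    infix 4 _#_ _#?_
    _#_ : Fin n → Fin n → Set
    x # y = x ≢ y × x ≁ y

    _#?_ : ∀ x y → Dec (x # y)
    x #? y = ¬? (x ≟ y) ×-dec ¬? (x ~? y)

    No4K₁ : Set
    No4K₁ = ∀ {a b c d} → a # b → a # c → a # d → b # c → b # d → c # d → ⊥

    bounded : No4K₁ → Colourable 4 G
    bounded no4K₁ = Search.search≡true⇒4-colourable G unforbidden 60 ([] ∷ []) Search.[]
      (λ _ → inj₂ (here refl)) search-succeeds
      where
      -- Only the pair p, q is left open: if adjacent, it yields a co-diamond, and otherwise 4K₁.
      -- The six choices of this pair match the last six alternatives in `forbidden`.
      sparse : ∀ {p q r s} → p ≢ q → p # r → p # s → q # r → q # s → r # s → ⊥
      sparse {p} {q} p≢q p#r@(_ , p≁r) p#s@(_ , p≁s) q#r@(_ , q≁r) q#s@(_ , q≁s) r#s@(r≢s , r≁s) with p ~? q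
      ... | yes pq = noCoDiamond pq r≢s (≁-sym p≁r) (≁-sym q≁r) (≁-sym p≁s) (≁-sym q≁s) r≁s
      ... | no p≁q = no4K₁ (p≢q , p≁q) p#r p#s q#r q#s r#s

      true⁻ : {A : Set} (a? : Dec A) → T (does a?) → A
      true⁻ (yes a) _ = a

      false⁻ : {A : Set} (a? : Dec A) → T (not (does a?)) → ¬ A
      false⁻ (no ¬a) _ = ¬a

      ∧⁻ : ∀ {a b} → T (a ∧ b) → T a × T b
      ∧⁻ {true} b = _ , b

      ∨⁻ : ∀ {a b} → T (a ∨ b) → T a ⊎ T b
      ∨⁻ {true}  t = inj₁ t
      ∨⁻ {false} t = inj₂ t

      none⁻ : ∀ {a b c d e} → T (not a ∧ not b ∧ not c ∧ not d ∧ not e) →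
              T (not a) × T (not b) × T (not c) × T (not d) × T (not e)
      none⁻ {false} {false} {false} {false} {false} _ = _

      #-sym : ∀ {x y} → x # y → y # x
      #-sym (x≢y , x≁y) = (x≢y ∘ sym) , ≁-sym x≁y

      unforbidden : Search.Unforbidden G
      unforbidden {x} {w} {i} {j} x≢w x≢i x≢j w≢i w≢j i≢j t with ∨⁻ t
      ... | inj₁ t =
        let xw , t = ∧⁻ t; xi , t = ∧⁻ t; xj , t = ∧⁻ t; wi , t = ∧⁻ t; wj , ij = ∧⁻ t in
        noK₄ (true⁻ (x ~? w) xw) (true⁻ (x ~? i) xi) (true⁻ (x ~? j) xj)
             (true⁻ (w ~? i) wi) (true⁻ (w ~? j) wj) (true⁻ (i ~? j) ij)
      ... | inj₂ t = cases t
        where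
        # : ∀ {y z} → y ≢ z → T (not (does (y ~? z))) → y # z
        # {y} {z} y≢z f = y≢z , false⁻ (y ~? z) f
        cases : _ → ⊥
        cases t with ∨⁻ t
        ... | inj₁ t = let xi , xj , wi , wj , ij = none⁻ {does (x ~? i)} t in
          sparse x≢w (# x≢i xi) (# x≢j xj) (# w≢i wi) (# w≢j wj) (# i≢j ij)
        ... | inj₂ t with ∨⁻ t
        ... | inj₁ t = let xw , xj , wi , wj , ij = none⁻ {does (x ~? w)} t in
          sparse x≢i (# x≢w xw) (# x≢j xj) (#-sym (# w≢i wi)) (# i≢j ij) (# w≢j wj)
        ... | inj₂ t with ∨⁻ t
        ... | inj₁ t = let xw , xi , wi , wj , ij = none⁻ {does (x ~? w)} t in
          sparse x≢j (# x≢w xw) (# x≢i xi) (#-sym (# w≢j wj)) (#-sym (# i≢j ij)) (# w≢i wi)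
        ... | inj₂ t with ∨⁻ t
        ... | inj₁ t = let xw , xi , xj , wj , ij = none⁻ {does (x ~? w)} t in
          sparse w≢i (#-sym (# x≢w xw)) (# w≢j wj) (#-sym (# x≢i xi)) (# i≢j ij) (# x≢j xj)
        ... | inj₂ t with ∨⁻ t
        ... | inj₁ t = let xw , xi , xj , wi , ij = none⁻ {does (x ~? w)} t in
          sparse w≢j (#-sym (# x≢w xw)) (# w≢i wi) (#-sym (# x≢j xj)) (#-sym (# i≢j ij)) (# x≢i xi)
        ... | inj₂ t = let xw , xi , xj , wi , wj = none⁻ {does (x ~? w)} t in
          sparse i≢j (#-sym (# x≢i xi)) (#-sym (# w≢i wi)) (#-sym (# x≢j xj)) (#-sym (# w≢j wj)) (# x≢w xw)

    -- M is an independent set containing a, b, c and d, and a vertex outside M has at most one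
    -- non-neighbour in M, so it takes four vertices outside M to miss each of a, b, c and d.
    module With4K₁ {a b c d : Fin n} (a#b : a # b) (a#c : a # c) (a#d : a # d)
                   (b#c : b # c) (b#d : b # d) (c#d : c # d) where

      M : VertexSet
      M x = a ≁ x × b ≁ x

      M? : Decidable M
      M? x = ¬? (a ~? x) ×-dec ¬? (b ~? x)

      -- An edge inside M would form a co-diamond with a and b.
      M-independent : Independent M
      M-independent (a≁x , b≁x) (a≁y , b≁y) xy = noCoDiamond xy (proj₁ a#b) a≁x a≁y b≁x b≁y (proj₂ a#b)

      -- Being outside M, x is adjacent to a or b; that edge and the nonadjacent vertices y, z of M
      -- would form a co-diamond.
      missesOne : ∀ {x y z} → ¬ M x → M y → M z → y ≢ z → x ≁ y → x ≁ z → ⊥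
      missesOne {x} ¬Mx My Mz y≢z x≁y x≁z with a ~? x | b ~? x
      ... | yes ax | _      = noCoDiamond ax y≢z (≁-sym (proj₁ My)) (≁-sym x≁y) (≁-sym (proj₁ Mz)) (≁-sym x≁z)
                                (M-independent My Mz)
      ... | no _   | yes bx = noCoDiamond bx y≢z (≁-sym (proj₂ My)) (≁-sym x≁y) (≁-sym (proj₂ Mz)) (≁-sym x≁z)
                                (M-independent My Mz)
      ... | no a≁x | no b≁x = ¬Mx (a≁x , b≁x)

      μ : Fin 4 → Fin n
      μ 0F = a
      μ 1F = b
      μ 2F = c
      μ 3F = d

      μ-in-M : ∀ i → M (μ i)
      μ-in-M 0F = ~-irrefl , ≁-sym (proj₂ a#b)
      μ-in-M 1F = proj₂ a#b , ~-irrefl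
      μ-in-M 2F = proj₂ a#c , proj₂ b#c
      μ-in-M 3F = proj₂ a#d , proj₂ b#d

      μ-distinct : ∀ i j → i Fin.< j → μ i ≢ μ j
      μ-distinct 0F 1F _ = proj₁ a#b
      μ-distinct 0F 2F _ = proj₁ a#c
      μ-distinct 0F 3F _ = proj₁ a#d
      μ-distinct 1F 2F _ = proj₁ b#c
      μ-distinct 1F 3F _ = proj₁ b#d
      μ-distinct 2F 3F _ = proj₁ c#d
      μ-distinct (suc _) 1F (s≤s ())
      μ-distinct (suc (suc _)) 2F (s≤s (s≤s ()))
      μ-distinct 3F 3F (s≤s (s≤s (s≤s ())))

      -- Each of a, b, c, d is missed by a vertex of the triangle, for otherwise there is a K₄. By
      -- pigeonhole one of the three vertices misses two of them.
      ∁M-triangle-free : TriangleFreeOn (λ x → ¬ M x)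
      ∁M-triangle-free {p} {q} {r} ¬Mp ¬Mq ¬Mr pq pr qr =
        let i , j , i<j , eq = Fin.pigeonhole (ℕ.n<1+n 3) (proj₁ ∘ missed)
        in missesOne (τ-outside _) (μ-in-M i) (μ-in-M j) (μ-distinct i j i<j) (proj₂ (missed i))
             (subst (λ k → τ k ≁ μ j) (sym eq) (proj₂ (missed j)))
        where
        τ : Fin 3 → Fin n
        τ 0F = p
        τ 1F = q
        τ 2F = r

        τ-outside : ∀ i → ¬ M (τ i)
        τ-outside 0F = ¬Mp
        τ-outside 1F = ¬Mq
        τ-outside 2F = ¬Mr

        missed : ∀ i → ∃[ j ] τ j ≁ μ i
        missed i with p ~? μ i | q ~? μ i | r ~? μ i
        ... | no p≁ | _     | _     = 0F , p≁
        ... | yes _ | no q≁ | _     = 1F , q≁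
        ... | yes _ | yes _ | no r≁ = 2F , r≁
        ... | yes pm | yes qm | yes rm = ⊥-elim (noK₄ pq pr pm qr qm rm)

      unbounded : Colourable 4 G
      unbounded = colourable
        (∪-colourable M? (independent⇒1-colourable M-independent)
                         (triangle-free⇒3-colourable noK₄ noCoGem (λ x → ¬? (M? x)) ∁M-triangle-free))
        λ x → decidable-stable (M? x ⊎-dec ¬? (M? x)) λ h → h (inj₂ (h ∘ inj₁))

    4-colourable : Colourable 4 G
    4-colourable with any? (λ a → any? (λ b → any? (λ c → any? (λ d →
           a #? b ×-dec a #? c ×-dec a #? d ×-dec b #? c ×-dec b #? d ×-dec c #? d))))
    ... | yes (_ , _ , _ , _ , a#b , a#c , a#d , b#c , b#d , c#d) = With4K₁.unbounded a#b a#c a#d b#c b#d c#d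
    ... | no none = bounded λ a#b a#c a#d b#c b#d c#d →
      none (_ , _ , _ , _ , a#b , a#c , a#d , b#c , b#d , c#d)

-- Graphs with a co-diamond

module CoDiamond {n : ℕ} (G : Graph (Fin n)) where
  open Adjacency G
  open Colouring G

  -- `reduce` is the induction hypothesis for the graph in which u is merged with v; its last two
  -- conditions are those of `Merge`.
  module _ (noCoGem : NoCoGem) (noK₄ : NoK₄)
    (reduce : ∀ {u v} → u ≢ v → u ≁ v →
      (∀ {c x} → u ~ c → v ≁ c → x ≢ v → x ≁ u → x ≁ v → c ~ x) →
      (∀ {c y z} → u ~ c → v ≁ c → c ~ y → c ~ z → y ~ z → u ~ y ⊎ v ~ y → u ~ z ⊎ v ~ z → ⊥) →
      Colourable 4 G)
    where

    -- For P₄-free Q, this is connectedness in the subgraph induced by Q.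
    Linked : VertexSet → Fin n → Fin n → Set
    Linked Q x y = x ≡ y ⊎ x ~ y ⊎ ∃[ z ] Q z × x ~ z × z ~ y

    module Link {Q : VertexSet} (Q? : Decidable Q) (P₄-free : P₄-FreeOn Q) where

      infix 4 _≈_ _≈?_
      _≈_ : Fin n → Fin n → Set
      _≈_ = Linked Q

      _≈?_ : ∀ x y → Dec (x ≈ y)
      x ≈? y = x ≟ y ⊎-dec x ~? y ⊎-dec any? λ z → Q? z ×-dec x ~? z ×-dec z ~? y

      ≈-refl : ∀ {x} → x ≈ x
      ≈-refl = inj₁ refl

      ≈-sym : ∀ {x y} → x ≈ y → y ≈ x
      ≈-sym (inj₁ eq)                       = inj₁ (sym eq)
      ≈-sym (inj₂ (inj₁ xy))                = inj₂ (inj₁ (~-sym xy))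
      ≈-sym (inj₂ (inj₂ (z , Qz , xz , zy))) = inj₂ (inj₂ (z , Qz , ~-sym zy , ~-sym xz))

      ~⇒≈ : ∀ {x y} → x ~ y → x ≈ y
      ~⇒≈ = inj₂ ∘ inj₁

      -- A walk x - w - y - z without a shortcut would be a P₄ in Q, so linked vertices stay within
      -- distance two.
      ≈-step : ∀ {x y z} → Q x → Q y → Q z → x ≈ y → y ~ z → x ≈ z
      ≈-step Qx Qy Qz (inj₁ refl)      yz = ~⇒≈ yz
      ≈-step Qx Qy Qz (inj₂ (inj₁ xy)) yz = inj₂ (inj₂ (_ , Qy , xy , yz))
      ≈-step {x} {y} {z} Qx Qy Qz (inj₂ (inj₂ (w , Qw , xw , wy))) yz
        with x ~? y | w ~? z | x ~? z
      ... | yes xy | _      | _      = inj₂ (inj₂ (y , Qy , xy , yz))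
      ... | no _   | yes wz | _      = inj₂ (inj₂ (w , Qw , xw , wz))
      ... | no _   | no _   | yes xz = ~⇒≈ xz
      ... | no x≁y | no w≁z | no x≁z = ⊥-elim (P₄-free Qx Qw Qy Qz (path xw wy yz x≁y x≁z w≁z))

      ≈-trans : ∀ {x y z} → Q x → Q y → Q z → x ≈ y → y ≈ z → x ≈ z
      ≈-trans Qx Qy Qz xy (inj₁ refl)      = xy
      ≈-trans Qx Qy Qz xy (inj₂ (inj₁ yz)) = ≈-step Qx Qy Qz xy yz
      ≈-trans Qx Qy Qz xy (inj₂ (inj₂ (w , Qw , yw , wz))) =
        ≈-step Qx Qw Qz (≈-step Qx Qy Qw xy yw) wz

      -- Along a path of length at most two from x to y, some edge leads from a neighbour of r to a
      -- non-neighbour.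
      mixedEdge : ∀ {r x y} → Q x → Q y → x ≈ y → r ~ x → r ≁ y →
        ∃[ p ] ∃[ q ] Q p × Q q × r ~ p × r ≁ q × p ~ q × x ≈ p × x ≈ q
      mixedEdge Qx Qy (inj₁ refl) rx r≁y = contradiction rx r≁y
      mixedEdge Qx Qy (inj₂ (inj₁ xy)) rx r≁y = _ , _ , Qx , Qy , rx , r≁y , xy , ≈-refl , ~⇒≈ xy
      mixedEdge {r} Qx Qy x≈y@(inj₂ (inj₂ (z , Qz , xz , zy))) rx r≁y with r ~? z
      ... | yes rz = z , _ , Qz , Qy , rz , r≁y , zy , ~⇒≈ xz , x≈y
      ... | no r≁z = _ , z , Qx , Qz , rx , r≁z , xz , ≈-refl , ~⇒≈ xz

    -- A maximal disconnected set with an edge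

    Avoiding : Subset n → VertexSet
    Avoiding Q z = z ∉ Q × (∀ q → q ∈ Q → z ≁ q)

    avoiding? : ∀ Q → Decidable (Avoiding Q)
    avoiding? Q z = ¬? (z Subset.∈? Q) ×-dec all? λ q → q Subset.∈? Q →-dec ¬? (z ~? q)

    avoided⇒P₄-free : ∀ {Q z} → Avoiding Q z → P₄-FreeOn (_∈ Q)
    avoided⇒P₄-free (_ , z≁) a b c d p = noCoGem p (z≁ _ a) (z≁ _ b) (z≁ _ c) (z≁ _ d)

    record Split (Q : Subset n) : Set where
      field
        {anchor a b left right} : Fin n
        avoids     : Avoiding Q anchor
        a∈         : a ∈ Q
        b∈         : b ∈ Q
        a~b        : a ~ b
        left∈      : left ∈ Q
        right∈     : right ∈ Q
        left≉right : ¬ Linked (_∈ Q) left right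

    -- The consequence of maximality that is used: an h violating it could be added to Q with z as
    -- the new anchor.
    Maximal : Subset n → Set
    Maximal Q = ∀ {z h q} → Avoiding Q z → h ∉ Q → h ≢ z → z ≁ h → q ∈ Q → h ~ q

    -- If h is nonadjacent to q ∈ Q, then q is linked in Q ∪ ⁅ h ⁆ only to what it was linked to in Q.
    grow : ∀ k {Q} → n ℕ.≤ Subset.∣ Q ∣ ℕ.+ k → Split Q → ∃[ Q′ ] Split Q′ × Maximal Q′
    grow k {Q} bound split
      with any? (λ z → any? (λ h → any? (λ q → avoiding? Q z ×-dec ¬? (h Subset.∈? Q) ×-dec ¬? (h ≟ z)
                  ×-dec ¬? (z ~? h) ×-dec q Subset.∈? Q ×-dec ¬? (h ~? q))))
    ... | no none = Q , split , λ {z} {h} {q} z-avoids h∉ h≢z z≁h q∈ → decidable-stable (h ~? q)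
      λ h≁q → none (z , h , q , z-avoids , h∉ , h≢z , z≁h , q∈ , h≁q)
    ... | yes (z , h , q , z-avoids@(z∉ , z≁) , h∉ , h≢z , z≁h , q∈ , h≁q) = continue k bound
      where
      open Split split
      open Link (Subset._∈? Q) (avoided⇒P₄-free z-avoids)

      Q′ : Subset n
      Q′ = Q Subset.∪ ⁅ h ⁆

      old : ∀ {x} → x ∈ Q → x ∈ Q′
      old = Subset.p⊆p∪q ⁅ h ⁆

      cases : ∀ {x} → x ∈ Q′ → x ∈ Q ⊎ x ≡ h
      cases x∈ = Sum.map id (Subset.x∈⁅y⁆⇒x≡y h) (Subset.x∈p∪q⁻ Q ⁅ h ⁆ x∈)

      avoids′ : Avoiding Q′ z
      avoids′ = (λ z∈ → Sum.[ z∉ , (h≢z ∘ sym) ]′ (cases z∈))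
              , λ x x∈ → Sum.[ z≁ x , (λ { refl → z≁h }) ]′ (cases x∈)

      unlinked : ∀ {x} → ¬ q ≈ x → ¬ Linked (_∈ Q′) q x
      unlinked q≉x (inj₁ q≡x) = q≉x (inj₁ q≡x)
      unlinked q≉x (inj₂ (inj₁ qx)) = q≉x (~⇒≈ qx)
      unlinked q≉x (inj₂ (inj₂ (y , y∈ , qy , yx))) with cases y∈
      ... | inj₁ y∈Q = q≉x (inj₂ (inj₂ (y , y∈Q , qy , yx)))
      ... | inj₂ refl = h≁q (~-sym qy)

      split′ : Split Q′
      -- As `left` and `right` are unlinked, q is unlinked to one of them in Q, and this pair stays
      -- unlinked after h is added.
      split′ with q ≈? left
      ... | no q≉left = record
        { avoids = avoids′ ; a∈ = old a∈ ; b∈ = old b∈ ; a~b = a~b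
        ; left∈ = old q∈ ; right∈ = old left∈ ; left≉right = unlinked q≉left }
      ... | yes q≈left = record
        { avoids = avoids′ ; a∈ = old a∈ ; b∈ = old b∈ ; a~b = a~b
        ; left∈ = old q∈ ; right∈ = old right∈
        ; left≉right = unlinked λ q≈right → left≉right (≈-trans left∈ q∈ right∈ (≈-sym q≈left) q≈right) }

      larger : Subset.∣ Q ∣ ℕ.< Subset.∣ Q′ ∣
      larger = Subset.p⊂q⇒∣p∣<∣q∣ (old , h , Subset.q⊆p∪q Q ⁅ h ⁆ (Subset.x∈⁅x⁆ h) , h∉)

      continue : ∀ k → n ℕ.≤ Subset.∣ Q ∣ ℕ.+ k → ∃[ Q″ ] Split Q″ × Maximal Q″
      -- Here Q already has n elements, which leaves no room for h.
      continue zero bound = contradiction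
        (ℕ.≤-trans larger (ℕ.≤-trans (Subset.∣p∣≤n Q′) (subst (n ℕ.≤_) (ℕ.+-identityʳ _) bound)))
        (ℕ.<-irrefl refl)
      continue (suc k) bound = grow k
        (ℕ.≤-trans bound (ℕ.≤-trans (ℕ.≤-reflexive (ℕ.+-suc Subset.∣ Q ∣ k)) (ℕ.+-monoˡ-≤ k larger))) split′

    -- Vertices outside Q: anticomplete (U), complete (Y) or mixed (R)

    module Frame (Q : Subset n) (split : Split Q) (maximal : Maximal Q) where
      open Split split using (anchor; avoids; left; right; left∈; right∈; left≉right)

      Q-P₄-free : P₄-FreeOn (_∈ Q)
      Q-P₄-free = avoided⇒P₄-free avoids

      open Link (Subset._∈? Q) Q-P₄-free

      U Y R : VertexSet
      U = Avoiding Q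
      Y y = y ∉ Q × (∀ q → q ∈ Q → y ~ q)
      R r = r ∉ Q × (∃[ q ] q ∈ Q × r ~ q) × (∃[ q ] q ∈ Q × r ≁ q)

      U? : Decidable U
      U? = avoiding? Q

      Y? : Decidable Y
      Y? y = ¬? (y Subset.∈? Q) ×-dec all? λ q → q Subset.∈? Q →-dec y ~? q

      R? : Decidable R
      R? r = ¬? (r Subset.∈? Q) ×-dec (any? λ q → q Subset.∈? Q ×-dec r ~? q)
                                ×-dec (any? λ q → q Subset.∈? Q ×-dec ¬? (r ~? q))

      data Class (x : Fin n) : Set where
        inQ : x ∈ Q → Class x
        inU : U x → Class x
        inY : Y x → Class x
        inR : R x → Class x

      classify : ∀ x → Class x
      classify x with x Subset.∈? Q
      ... | yes x∈ = inQ x∈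
      ... | no x∉ with any? (λ q → q Subset.∈? Q ×-dec x ~? q)
      ...   | no none = inU (x∉ , λ q q∈ xq → none (q , q∈ , xq))
      ...   | yes some with any? (λ q → q Subset.∈? Q ×-dec ¬? (x ~? q))
      ...     | no all = inY (x∉ , λ q q∈ → decidable-stable (x ~? q) λ x≁q → all (q , q∈ , x≁q))
      ...     | yes notAll = inR (x∉ , some , notAll)

      -- If u missed r, maximality would make r complete to Q. The same argument gives `U-clique`.
      U~R : ∀ {u r} → U u → R r → u ~ r
      U~R {u} {r} Uu@(u∉ , u≁) (r∉ , (p , p∈ , rp) , q , q∈ , r≁q) = decidable-stable (u ~? r) λ u≁r →
        r≁q (maximal Uu r∉ (λ { refl → u≁ p p∈ rp }) u≁r q∈)

      U-clique : ∀ {u u′} → U u → U u′ → u ≢ u′ → u ~ u′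
      U-clique {u} {u′} Uu (u′∉ , u′≁) u≢u′ = decidable-stable (u ~? u′) λ u≁u′ →
        u′≁ left left∈ (maximal Uu u′∉ (u≢u′ ∘ sym) u≁u′ left∈)

      QU : VertexSet
      QU x = x ∈ Q ⊎ U x

      QU? : Decidable QU
      QU? x = x Subset.∈? Q ⊎-dec U? x

      QU-sameSide : ∀ {x y} → QU x → QU y → x ~ y → (x ∈ Q × y ∈ Q) ⊎ (U x × U y)
      QU-sameSide (inj₁ x∈)       (inj₁ y∈)       _  = inj₁ (x∈ , y∈)
      QU-sameSide (inj₁ x∈)       (inj₂ (_ , y≁)) xy = contradiction (~-sym xy) (y≁ _ x∈)
      QU-sameSide (inj₂ (_ , x≁)) (inj₁ y∈)       xy = contradiction xy (x≁ _ y∈)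
      QU-sameSide (inj₂ Ux)       (inj₂ Uy)       _  = inj₂ (Ux , Uy)

      -- No edge joins Q to U, so a P₄ would lie inside Q or inside the clique U.
      QU-P₄-free : P₄-FreeOn QU
      QU-P₄-free a∈ b∈ c∈ d∈ p@(path ab bc cd a≁c a≁d b≁d) with QU-sameSide a∈ b∈ ab
      ... | inj₁ (a∈Q , b∈Q) = Q-P₄-free a∈Q b∈Q c∈Q (sideQ c∈Q d∈ cd) p
        where
        sideQ : ∀ {x y} → x ∈ Q → QU y → x ~ y → y ∈ Q
        sideQ x∈ (inj₁ y∈)       _  = y∈
        sideQ x∈ (inj₂ (_ , y≁)) xy = contradiction (~-sym xy) (y≁ _ x∈)
        c∈Q = sideQ b∈Q c∈ bc
      ... | inj₂ (Ua , Ub) with QU-sameSide b∈ c∈ bc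
      ...   | inj₁ (b∈Q , _) = proj₁ Ub b∈Q
      ...   | inj₂ (_ , Uc) = a≁c (U-clique Ua Uc λ { refl → a≁d cd })

      QU-3-colourable : ColourableOn 3 QU
      QU-3-colourable = P₄-free⇒3-colourable noK₄ QU? QU-P₄-free

      QU-2-colourable : TriangleFreeOn (_∈ Q) → TriangleFreeOn U → ColourableOn 2 QU
      QU-2-colourable Q-free U-free = P₄-free∧triangle-free⇒2-colourable noK₄ QU? QU-P₄-free free
        where
        free : TriangleFreeOn QU
        free a∈ b∈ c∈ ab ac bc with QU-sameSide a∈ b∈ ab | QU-sameSide a∈ c∈ ac
        ... | inj₁ (a∈Q , b∈Q) | inj₁ (_ , c∈Q) = Q-free a∈Q b∈Q c∈Q ab ac bc
        ... | inj₂ (Ua , Ub)   | inj₂ (_ , Uc)  = U-free Ua Ub Uc ab ac bc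
        ... | inj₁ (a∈Q , _)   | inj₂ (Ua , _)  = proj₁ Ua a∈Q
        ... | inj₂ (Ua , _)    | inj₁ (a∈Q , _) = proj₁ Ua a∈Q

      -- An edge of Y and the edge a b of Q would form a K₄.
      Y-independent : Independent Y
      Y-independent (_ , y~) (_ , y′~) yy′ =
        noK₄ yy′ (y~ _ a∈) (y~ _ b∈) (y′~ _ a∈) (y′~ _ b∈) a~b
        where open Split split using (a∈; b∈; a~b)

      Y⇒Q-triangle-free : ∀ {y} → Y y → TriangleFreeOn (_∈ Q)
      Y⇒Q-triangle-free (_ , y~) a∈ b∈ c∈ = noK₄ (y~ _ a∈) (y~ _ b∈) (y~ _ c∈)

      R-independent : ∀ {u u′} → U u → U u′ → u ≢ u′ → Independent R
      R-independent Uu Uu′ u≢u′ Rr Rr′ rr′ =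
        noK₄ (U-clique Uu Uu′ u≢u′) (U~R Uu Rr) (U~R Uu Rr′) (U~R Uu′ Rr) (U~R Uu′ Rr′) rr′

      -- Both Y and R are independent, and Q ∪ U takes three colours, which suffices if Y or R is
      -- empty. Otherwise a vertex of Y makes Q triangle-free and a vertex of R makes U
      -- triangle-free, so Q ∪ U takes only two.
      twoAvoiders : ∀ {u u′} → U u → U u′ → u ≢ u′ → Colourable 4 G
      twoAvoiders {u} {u′} Uu Uu′ u≢u′ with any? Y? | any? R?
      ... | no noY | _ = colourable (∪-colourable QU? QU-3-colourable
              (independent⇒1-colourable (R-independent Uu Uu′ u≢u′))) all
        where
        all : ∀ x → (QU ∪ R) x
        all x with classify x
        ... | inQ x∈ = inj₁ (inj₁ x∈)
        ... | inU Ux = inj₁ (inj₂ Ux)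
        ... | inY Yx = contradiction (x , Yx) noY
        ... | inR Rx = inj₂ Rx
      ... | yes _ | no noR = colourable (∪-colourable QU? QU-3-colourable
              (independent⇒1-colourable Y-independent)) all
        where
        all : ∀ x → (QU ∪ Y) x
        all x with classify x
        ... | inQ x∈ = inj₁ (inj₁ x∈)
        ... | inU Ux = inj₁ (inj₂ Ux)
        ... | inY Yx = inj₂ Yx
        ... | inR Rx = contradiction (x , Rx) noR
      ... | yes (y , Yy) | yes (r , Rr) =
        colourable (∪-colourable QU? (QU-2-colourable (Y⇒Q-triangle-free Yy) U-triangle-free)
          (∪-colourable Y? (independent⇒1-colourable Y-independent)
            (independent⇒1-colourable (R-independent Uu Uu′ u≢u′)))) all
        where
        U-triangle-free : TriangleFreeOn U
        U-triangle-free Ua Ub Uc ab ac bc = noK₄ ab ac (U~R Ua Rr) bc (U~R Ub Rr) (U~R Uc Rr)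
        all : ∀ x → (QU ∪ (Y ∪ R)) x
        all x with classify x
        ... | inQ x∈ = inj₁ (inj₁ x∈)
        ... | inU Ux = inj₁ (inj₂ Ux)
        ... | inY Yx = inj₂ (inj₁ Yx)
        ... | inR Rx = inj₂ (inj₂ Rx)

      -- The case U = {v}

      module OneAvoider {v : Fin n} (Uv : U v) (unique : ∀ {u} → U u → u ≡ v) where

        v≁ : ∀ {q} → q ∈ Q → v ≁ q
        v≁ = proj₂ Uv _

        v~R : ∀ {r} → R r → v ~ r
        v~R = U~R Uv

        -- With p q from `mixedEdge`, v - r - p - q is a P₄. Since l lies in another component of Q,
        -- it misses v, p and q, so it must meet r.
        mixed : ∀ {r x y l} → R r → x ∈ Q → y ∈ Q → l ∈ Q → x ≈ y → r ~ x → r ≁ y → ¬ x ≈ l → r ~ l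
        mixed {r} {l = l} Rr x∈ y∈ l∈ x≈y rx r≁y x≉l
          with p , q , p∈ , q∈ , rp , r≁q , pq , x≈p , x≈q ← mixedEdge x∈ y∈ x≈y rx r≁y
          = decidable-stable (r ~? l) λ r≁l →
            noCoGem (path (v~R Rr) rp pq (v≁ p∈) (v≁ q∈) r≁q) (≁-sym (v≁ l∈)) (≁-sym r≁l)
              (λ lp → x≉l (≈-step x∈ p∈ l∈ x≈p (~-sym lp)))
              (λ lq → x≉l (≈-step x∈ q∈ l∈ x≈q (~-sym lq)))

        -- Otherwise i - r - v - s would be a P₄ that l misses.
        separated⇒adjacent : ∀ {r s i l} → R r → R s → i ∈ Q → l ∈ Q →
          r ~ i → s ≁ i → l ≁ i → l ≁ r → l ≁ s → r ~ s
        separated⇒adjacent {r} {s} Rr Rs i∈ l∈ ri s≁i l≁i l≁r l≁s = decidable-stable (r ~? s) λ r≁s →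
          noCoGem (path (~-sym ri) (~-sym (v~R Rr)) (v~R Rs) (≁-sym (v≁ i∈)) (≁-sym s≁i) r≁s)
            l≁i l≁r (≁-sym (v≁ l∈)) l≁s

        -- The component of an edge a b of Q: R splits into C (complete to it) and N

        module Edge {a b q₀ : Fin n} (a∈ : a ∈ Q) (b∈ : b ∈ Q) (a~b : a ~ b)
                    (q₀∈ : q₀ ∈ Q) (a≉q₀ : ¬ a ≈ q₀) where

          C N : VertexSet
          C r = R r × (∀ x → x ∈ Q → a ≈ x → r ~ x)
          N r = R r × (∃[ x ] x ∈ Q × a ≈ x × r ≁ x)

          N? : Decidable N
          N? r = R? r ×-dec any? λ x → x Subset.∈? Q ×-dec a ≈? x ×-dec ¬? (r ~? x)

          R⇒C⊎N : ∀ {r} → R r → C r ⊎ N r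
          R⇒C⊎N {r} Rr with any? (λ x → x Subset.∈? Q ×-dec a ≈? x ×-dec ¬? (r ~? x))
          ... | yes misses = inj₂ (Rr , misses)
          ... | no none = inj₁ (Rr , λ x x∈ a≈x → decidable-stable (r ~? x) λ r≁x → none (x , x∈ , a≈x , r≁x))

          N-mixed : ∀ {t x l} → N t → x ∈ Q → a ≈ x → t ~ x → l ∈ Q → ¬ a ≈ l → t ~ l
          N-mixed (Rt , y , y∈ , a≈y , t≁y) x∈ a≈x tx l∈ a≉l =
            mixed Rt x∈ y∈ l∈ (≈-trans x∈ a∈ y∈ (≈-sym a≈x) a≈y) tx t≁y
              (λ x≈l → a≉l (≈-trans a∈ x∈ l∈ a≈x x≈l))

          ≉⇒≁ : ∀ {x y} → x ∈ Q → y ∈ Q → a ≈ x → ¬ a ≈ y → x ≁ y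
          ≉⇒≁ x∈ y∈ a≈x a≉y xy = a≉y (≈-step a∈ x∈ y∈ a≈x xy)

          YC : VertexSet
          YC x = Y x ⊎ C x

          YC-edge : ∀ {x} → YC x → x ~ a × x ~ b
          YC-edge (inj₁ (_ , y~)) = y~ a a∈ , y~ b b∈
          YC-edge (inj₂ (_ , c~)) = c~ a a∈ ≈-refl , c~ b b∈ (~⇒≈ a~b)

          -- Y and C are both complete to the edge a b, so together they need one colour.
          YC-independent : Independent YC
          YC-independent x∈ y∈ xy =
            let xa , xb = YC-edge x∈; ya , yb = YC-edge y∈ in noK₄ xy xa xb ya yb a~b

          -- A vertex of N complete to an edge of another component

          module Pivot {t₀ q q′ : Fin n} (Nt₀ : N t₀) (q∈ : q ∈ Q) (q′∈ : q′ ∈ Q) (q~q′ : q ~ q′)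
                       (a≉q : ¬ a ≈ q) (t₀~q : t₀ ~ q) (t₀~q′ : t₀ ~ q′) where

            W X : VertexSet
            W t = N t × ¬ (t ~ q × t ~ q′)
            X t = N t × (t ~ q × t ~ q′)

            X? : Decidable X
            X? t = N? t ×-dec t ~? q ×-dec t ~? q′

            W? : Decidable W
            W? t = N? t ×-dec ¬? (t ~? q ×-dec t ~? q′)

            a≉q′ : ¬ a ≈ q′
            a≉q′ a≈q′ = a≉q (≈-step a∈ q′∈ q∈ a≈q′ (~-sym q~q′))

            -- A vertex of N that meets the component of a is complete to the others by `N-mixed`,
            -- hence adjacent to q and q′.
            W-avoids-a : ∀ {w x} → W w → x ∈ Q → a ≈ x → w ≁ x
            W-avoids-a (Nw , ¬both) x∈ a≈x wx =
              ¬both (N-mixed Nw x∈ a≈x wx q∈ a≉q , N-mixed Nw x∈ a≈x wx q′∈ a≉q′)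

            -- If w were mixed on a component other than that of a, then `mixed` would make it
            -- adjacent to a.
            W-unmixed : ∀ {w x y} → W w → x ∈ Q → y ∈ Q → x ≈ y → w ~ x → w ~ y
            W-unmixed {w} {x} {y} Ww@((Rw , _) , _) x∈ y∈ x≈y wx = decidable-stable (w ~? y) λ w≁y →
              W-avoids-a Ww a∈ ≈-refl
                (mixed Rw x∈ y∈ a∈ x≈y wx w≁y λ x≈a → W-avoids-a Ww x∈ (≈-sym x≈a) wx)

            -- The witness i is q or q′, whichever w misses, so every vertex of X is adjacent to it.
            missed : ∀ {w} → W w → ∃[ i ] i ∈ Q × ¬ a ≈ i × w ≁ i × (∀ {t} → t ~ q × t ~ q′ → t ~ i)
            missed {w} (_ , ¬both) with w ~? q | w ~? q′
            ... | no w≁q | _       = q , q∈ , a≉q , w≁q , proj₁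
            ... | yes _  | no w≁q′ = q′ , q′∈ , a≉q′ , w≁q′ , proj₂
            ... | yes wq | yes wq′ = contradiction (wq , wq′) ¬both

            -- The vertex i separates t from w, and a vertex l linked to a that t misses is missed
            -- by w too.
            X~W : ∀ {t w} → X t → W w → t ~ w
            X~W ((Rt , l , l∈ , a≈l , t≁l) , both) Ww@((Rw , _) , _) =
              let i , i∈ , a≉i , w≁i , meets = missed Ww in
              separated⇒adjacent Rt Rw i∈ l∈ (meets both) w≁i (≉⇒≁ l∈ i∈ a≈l a≉i)
                (≁-sym t≁l) (≁-sym (W-avoids-a Ww l∈ a≈l))

            Xt₀ : X t₀
            Xt₀ = Nt₀ , t₀~q , t₀~q′

            -- An edge of W would form a K₄ with the edge v t₀, as both v and t₀ are complete to W.
            W-independent : Independent W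
            W-independent Ww@((Rw , _) , _) Ww′@((Rw′ , _) , _) ww′ =
              noK₄ (v~R (proj₁ Nt₀)) (v~R Rw) (v~R Rw′) (X~W Xt₀ Ww) (X~W Xt₀ Ww′) ww′

            X-independent : Independent X
            X-independent (_ , tq , tq′) (_ , sq , sq′) ts = noK₄ ts tq tq′ sq sq′ q~q′

            -- t₀ is adjacent to each neighbour of w in Q, for otherwise i – t₀ – w – e is a P₄ that
            -- misses some l linked to a.
            t₀~ : ∀ {w e} → W w → e ∈ Q → w ~ e → t₀ ~ e
            t₀~ {w} {e} Ww e∈ we = decidable-stable (t₀ ~? e) λ t₀≁e →
              let i , i∈ , a≉i , w≁i , meets = missed Ww
                  _ , l , l∈ , a≈l , t₀≁l = Nt₀
                  a≉e = λ a≈e → W-avoids-a Ww e∈ a≈e we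
              in noCoGem
                (path (~-sym (meets (t₀~q , t₀~q′))) (X~W Xt₀ Ww) we (≁-sym w≁i)
                  (λ ie → w≁i (W-unmixed Ww e∈ i∈ (~⇒≈ (~-sym ie)) we)) t₀≁e)
                (≉⇒≁ l∈ i∈ a≈l a≉i) (≁-sym t₀≁l) (≁-sym (W-avoids-a Ww l∈ a≈l)) (≉⇒≁ l∈ e∈ a≈l a≉e)

            -- If w met e, it would also meet e′, and so would t₀, giving the K₄ on t₀, w, e, e′.
            W-avoids-edges : ∀ {w e e′} → W w → e ∈ Q → e′ ∈ Q → e ~ e′ → w ≁ e
            W-avoids-edges Ww e∈ e′∈ ee′ we =
              let we′ = W-unmixed Ww e∈ e′∈ (~⇒≈ ee′) we in
              noK₄ (X~W Xt₀ Ww) (t₀~ Ww e∈ we) (t₀~ Ww e′∈ we′) we we′ ee′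

            N⊆W∪X : ∀ {t} → N t → (W ∪ X) t
            N⊆W∪X {t} Nt with t ~? q ×-dec t ~? q′
            ... | yes both = inj₂ (Nt , both)
            ... | no ¬both = inj₁ (Nt , ¬both)

          HasPivot : Set
          HasPivot = ∃[ t ] ∃[ q ] ∃[ q′ ] N t × q ∈ Q × q′ ∈ Q × q ~ q′ × ¬ a ≈ q × t ~ q × t ~ q′

          pivot? : Dec HasPivot
          pivot? = any? λ t → any? λ q → any? λ q′ →
            N? t ×-dec q Subset.∈? Q ×-dec q′ Subset.∈? Q ×-dec q ~? q′
              ×-dec ¬? (a ≈? q) ×-dec t ~? q ×-dec t ~? q′

          Nontrivial : VertexSet
          Nontrivial x = ∃[ y ] y ∈ Q × x ~ y

          nontrivial? : Decidable Nontrivial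
          nontrivial? x = any? λ y → y Subset.∈? Q ×-dec x ~? y

          -- If t also met y, it would be a pivot. If not, t is mixed on the component of x and
          -- hence adjacent to a, and then `N-mixed` makes it adjacent to y after all.
          noPivot⇒avoids-edges : ¬ HasPivot → ∀ {t x} → N t → x ∈ Q → Nontrivial x → ¬ a ≈ x → t ≁ x
          noPivot⇒avoids-edges noPivot {t} {x} Nt x∈ (y , y∈ , xy) a≉x tx with t ~? y
          ... | yes ty = noPivot (t , x , y , Nt , x∈ , y∈ , xy , a≉x , tx , ty)
          ... | no t≁y = t≁y (N-mixed Nt a∈ ≈-refl ta y∈ λ a≈y → a≉x (≈-step a∈ y∈ x∈ a≈y (~-sym xy)))
            where
            ta : t ~ a
            ta = mixed (proj₁ Nt) x∈ y∈ a∈ (~⇒≈ xy) tx t≁y (a≉x ∘ ≈-sym)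

          -- Q contains a triangle

          module Triangle {e : Fin n} (e∈ : e ∈ Q) (ae : a ~ e) (be : b ~ e) where

            noY : ∀ {y} → ¬ Y y
            noY Yy = Y⇒Q-triangle-free Yy a∈ b∈ e∈ a~b ae be

            -- A vertex of C would be complete to the triangle a b e.
            R⇒N : ∀ {r} → R r → N r
            R⇒N Rr with R⇒C⊎N Rr
            ... | inj₂ Nr = Nr
            ... | inj₁ (_ , r~) =
              ⊥-elim (noK₄ (r~ a a∈ ≈-refl) (r~ b b∈ (~⇒≈ a~b)) (r~ e e∈ (~⇒≈ ae)) a~b ae be)

            R-independent⇒4-colourable : Independent R → Colourable 4 G
            R-independent⇒4-colourable independent =
              colourable (∪-colourable QU? QU-3-colourable (independent⇒1-colourable independent)) all
              where
              all : ∀ x → (QU ∪ R) x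
              all x with classify x
              ... | inQ x∈ = inj₁ (inj₁ x∈)
              ... | inU Ux = inj₁ (inj₂ Ux)
              ... | inY Yx = contradiction Yx noY
              ... | inR Rx = inj₂ Rx

            -- An isolated vertex of Q is dominated by v.
            isolated⇒4-colourable : ∀ {x} → x ∈ Q → ¬ Nontrivial x → Colourable 4 G
            isolated⇒4-colourable {x} x∈ isolated =
              reduce (λ { refl → proj₁ Uv x∈ }) (≁-sym (v≁ x∈))
                (λ xc v≁c → contradiction xc (dominated v≁c)) (λ xc v≁c → contradiction xc (dominated v≁c))
              where
              dominated : ∀ {c} → v ≁ c → x ≁ c
              dominated {c} v≁c xc with classify c
              ... | inQ c∈ = isolated (c , c∈ , xc)
              ... | inU Uc with refl ← unique Uc = v≁ x∈ (~-sym xc)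
              ... | inY Yc = noY Yc
              ... | inR Rc = v≁c (v~R Rc)

            -- Once no vertex of Q is isolated, every neighbour in Q of a vertex of R lies on an
            -- edge of Q. So R lies in X if there is a pivot, and R is empty if there is none.
            4-colourable : Colourable 4 G
            4-colourable with any? (λ x → x Subset.∈? Q ×-dec ¬? (nontrivial? x))
            ... | yes (x , x∈ , isolated) = isolated⇒4-colourable x∈ isolated
            ... | no noIsolated with pivot?
            ...   | yes (t , q , q′ , Nt , q∈ , q′∈ , qq′ , a≉q , tq , tq′) =
              R-independent⇒4-colourable λ Rr Rs → X-independent (R⇒X Rr) (R⇒X Rs)
              where
              open Pivot Nt q∈ q′∈ qq′ a≉q tq tq′
              R⇒X : ∀ {r} → R r → X r
              R⇒X {r} Rr@(_ , (x , x∈ , rx) , _) with N⊆W∪X (R⇒N Rr) | nontrivial? x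
              ... | inj₂ Xr | _ = Xr
              ... | inj₁ Wr | yes (y , y∈ , xy) = contradiction rx (W-avoids-edges Wr x∈ y∈ xy)
              ... | inj₁ Wr | no isolated = contradiction (x , x∈ , isolated) noIsolated
            ...   | no noPivot = R-independent⇒4-colourable λ Rr → ⊥-elim (noR Rr)
              where
              nontrivial : ∀ {x} → x ∈ Q → Nontrivial x
              nontrivial {x} x∈ = decidable-stable (nontrivial? x) λ isolated → noIsolated (x , x∈ , isolated)
              noR : ∀ {r} → ¬ R r
              noR {r} Rr@(_ , (x , x∈ , rx) , _) with a ≈? x
              ... | no a≉x = noPivot⇒avoids-edges noPivot (R⇒N Rr) x∈ (nontrivial x∈) a≉x rx
              ... | yes a≈x = noPivot⇒avoids-edges noPivot (R⇒N Rr) q₀∈ (nontrivial q₀∈) a≉q₀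
                                (N-mixed (R⇒N Rr) x∈ a≈x rx q₀∈ a≉q₀)

          -- Q is triangle-free

          module TriangleFree (Q-triangle-free : TriangleFreeOn (_∈ Q)) where

            private
              Q-colouring : ColourableOn 2 (_∈ Q)
              Q-colouring = P₄-free∧triangle-free⇒2-colourable noK₄ (Subset._∈? Q) Q-P₄-free Q-triangle-free

            -- Isolated vertices of Q get colour 0, so that colour 1 is free for W.
            QvW-colourable : ∀ {W} → Decidable W → W ⊆ R → Independent W →
              (∀ {w x} → W w → x ∈ Q → Nontrivial x → w ≁ x) →
              ColourableOn 2 (λ x → (x ∈ Q ⊎ x ≡ v) ⊎ W x)
            QvW-colourable {W} W? W⊆R independent avoids-edges = c , proper
              where
              c : Fin n → Fin 2
              c x = if does (W? x) then 1F else
                    if does (x Subset.∈? Q ×-dec nontrivial? x) then proj₁ Q-colouring x else 0F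

              Qv : VertexSet
              Qv x = x ∈ Q ⊎ x ≡ v

              Qv-edge : ∀ {x y} → Qv x → Qv y → x ~ y → x ∈ Q × y ∈ Q
              Qv-edge (inj₁ x∈)   (inj₁ y∈)   _  = x∈ , y∈
              Qv-edge (inj₁ x∈)   (inj₂ refl) xy = contradiction (~-sym xy) (v≁ x∈)
              Qv-edge (inj₂ refl) (inj₁ y∈)   xy = contradiction xy (v≁ y∈)
              Qv-edge (inj₂ refl) (inj₂ refl) xy = contradiction xy ~-irrefl

              c-W : ∀ {w} → W w → c w ≡ 1F
              c-W {w} Ww rewrite dec-true (W? w) Ww = refl

              c-Q : ∀ {x} → ¬ W x → x ∈ Q → Nontrivial x → c x ≡ proj₁ Q-colouring x
              c-Q {x} ¬Wx x∈ nt
                rewrite dec-false (W? x) ¬Wx | dec-true (x Subset.∈? Q ×-dec nontrivial? x) (x∈ , nt) = refl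

              c-rest : ∀ {x} → ¬ W x → ¬ (x ∈ Q × Nontrivial x) → c x ≡ 0F
              c-rest {x} ¬Wx trivial
                rewrite dec-false (W? x) ¬Wx | dec-false (x Subset.∈? Q ×-dec nontrivial? x) trivial = refl

              mixedColours : ∀ {x w} → ¬ W x → W w → x ~ w → c x ≢ 1F
              mixedColours ¬Wx Ww xw eq
                with () ← trans (sym (c-rest ¬Wx λ (x∈ , nt) → avoids-edges Ww x∈ nt (~-sym xw))) eq

              inQv : ∀ {x} → ¬ W x → Qv x ⊎ W x → Qv x
              inQv ¬Wx (inj₁ x∈) = x∈
              inQv ¬Wx (inj₂ Wx) = contradiction Wx ¬Wx

              proper : ProperOn (λ x → Qv x ⊎ W x) c
              proper {x} {y} x∈ y∈ xy eq = go (W? x) (W? y)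
                where
                go : Dec (W x) → Dec (W y) → ⊥
                go (yes Wx) (yes Wy) = independent Wx Wy xy
                go (yes Wx) (no ¬Wy) = mixedColours ¬Wy Wx (~-sym xy) (trans (sym eq) (c-W Wx))
                go (no ¬Wx) (yes Wy) = mixedColours ¬Wx Wy xy (trans eq (c-W Wy))
                go (no ¬Wx) (no ¬Wy) =
                  let x∈Q , y∈Q = Qv-edge (inQv ¬Wx x∈) (inQv ¬Wy y∈) xy in
                  proj₂ Q-colouring x∈Q y∈Q xy (trans (sym (c-Q ¬Wx x∈Q (y , y∈Q , xy)))
                    (trans eq (c-Q ¬Wy y∈Q (x , x∈Q , ~-sym xy))))

            -- W shares the two colours of Q ∪ {v}; X and Y ∪ C get one further colour each.
            finish : ∀ {W X} → Decidable W → Decidable X → W ⊆ R → Independent W →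
              (∀ {w x} → W w → x ∈ Q → Nontrivial x → w ≁ x) → Independent X → N ⊆ W ∪ X → Colourable 4 G
            finish {W} {X} W? X? W⊆R W-independent avoids-edges X-independent N⊆ =
              colourable (∪-colourable S? (QvW-colourable W? W⊆R W-independent avoids-edges)
                (∪-colourable X? (independent⇒1-colourable X-independent)
                  (independent⇒1-colourable YC-independent))) all
              where
              S : VertexSet
              S x = (x ∈ Q ⊎ x ≡ v) ⊎ W x
              S? : Decidable S
              S? x = (x Subset.∈? Q ⊎-dec x ≟ v) ⊎-dec W? x
              all : ∀ x → (S ∪ (X ∪ YC)) x
              all x with classify x
              ... | inQ x∈ = inj₁ (inj₁ (inj₁ x∈))
              ... | inU Ux = inj₁ (inj₁ (inj₂ (unique Ux)))
              ... | inY Yx = inj₂ (inj₂ (inj₁ Yx))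
              ... | inR Rx with R⇒C⊎N Rx
              ...   | inj₁ Cx = inj₂ (inj₂ (inj₂ Cx))
              ...   | inj₂ Nx with N⊆ Nx
              ...     | inj₁ Wx = inj₁ (inj₂ Wx)
              ...     | inj₂ Xx = inj₂ (inj₁ Xx)

            module NoPivot (noPivot : ¬ HasPivot) where

              Misses : VertexSet
              Misses t = ∃[ l ] l ∈ Q × ¬ a ≈ l × t ≁ l

              misses? : Decidable Misses
              misses? t = any? λ l → l Subset.∈? Q ×-dec ¬? (a ≈? l) ×-dec ¬? (t ~? l)

              W X : VertexSet
              W t = N t × Misses t
              X t = N t × ¬ Misses t

              W? : Decidable W
              W? t = N? t ×-dec misses? t

              X? : Decidable X
              X? t = N? t ×-dec ¬? (misses? t)

              X-meets : ∀ {t l} → X t → l ∈ Q → ¬ a ≈ l → t ~ l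
              X-meets {t} {l} (_ , ¬misses) l∈ a≉l = decidable-stable (t ~? l)
                λ t≁l → ¬misses (l , l∈ , a≉l , t≁l)

              W-avoids-a : ∀ {w x} → W w → x ∈ Q → a ≈ x → w ≁ x
              W-avoids-a (Nw , l , l∈ , a≉l , w≁l) x∈ a≈x wx = w≁l (N-mixed Nw x∈ a≈x wx l∈ a≉l)

              W-avoids-edges : ∀ {w x} → W w → x ∈ Q → Nontrivial x → w ≁ x
              W-avoids-edges {x = x} Ww@(Nw , _) x∈ nt with a ≈? x
              ... | yes a≈x = W-avoids-a Ww x∈ a≈x
              ... | no a≉x = noPivot⇒avoids-edges noPivot Nw x∈ nt a≉x

              -- Here l separates t from w, while k, linked to a, is missed by both.
              X~W : ∀ {t w} → X t → W w → t ~ w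
              X~W Xt@((Rt , k , k∈ , a≈k , t≁k) , _) Ww@((Rw , _) , l , l∈ , a≉l , w≁l) =
                separated⇒adjacent Rt Rw l∈ k∈ (X-meets Xt l∈ a≉l) w≁l (≉⇒≁ k∈ l∈ a≈k a≉l)
                  (≁-sym t≁k) (≁-sym (W-avoids-a Ww k∈ a≈k))

              N⊆W∪X : N ⊆ W ∪ X
              N⊆W∪X {t} Nt with misses? t
              ... | yes m = inj₁ (Nt , m)
              ... | no ¬m = inj₂ (Nt , ¬m)

              -- X and W are complete to each other, and v is complete to both. An edge inside one
              -- of them would form a K₄ with v and a vertex of the other.
              bothNonempty : ∃ W → ∃ X → Colourable 4 G
              bothNonempty (w , Ww@((Rw , _) , _)) (t , Xt@((Rt , _) , _)) = finish W? X? (proj₁ ∘ proj₁)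
                (λ Ww@((Rw , _) , _) Ww′@((Rw′ , _) , _) ww′ →
                  noK₄ (v~R Rt) (v~R Rw) (v~R Rw′) (X~W Xt Ww) (X~W Xt Ww′) ww′)
                W-avoids-edges
                (λ Xs@((Rs , _) , _) Xs′@((Rs′ , _) , _) ss′ →
                  noK₄ (v~R Rs) (v~R Rs′) (v~R Rw) ss′ (X~W Xs Ww) (X~W Xs′ Ww))
                N⊆W∪X

              module XEmpty (noX : ¬ ∃ X) where

                N⇒W : ∀ {t} → N t → W t
                N⇒W {t} Nt with N⊆W∪X Nt
                ... | inj₁ Wt = Wt
                ... | inj₂ Xt = contradiction (t , Xt) noX

                a≁N : ∀ {t} → N t → a ≁ t
                a≁N Nt = ≁-sym (W-avoids-a (N⇒W Nt) a∈ ≈-refl)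

                -- All of N misses a, so a P₄ in N would give a co-gem; all of N is adjacent to v,
                -- so a triangle in N would give a K₄.
                N-colouring : ColourableOn 2 N
                N-colouring = P₄-free∧triangle-free⇒2-colourable noK₄ N?
                  (λ Na Nb Nc Nd p → noCoGem p (a≁N Na) (a≁N Nb) (a≁N Nc) (a≁N Nd))
                  (λ (Ra , _) (Rb , _) (Rc , _) → noK₄ (v~R Ra) (v~R Rb) (v~R Rc))

                combine : ColourableOn 2 N → Colourable 4 G
                combine (c , proper) =
                  -- The two colour classes of N play the roles of W and X.
                  finish (side? 0F) (side? 1F) (λ (Nx , _) → proj₁ Nx) (side-independent 0F)
                    (λ (Nw , _) → W-avoids-edges (N⇒W Nw)) (side-independent 1F)
                    λ {t} Nt → split-N Nt (c t) refl
                  where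
                  Side : Fin 2 → VertexSet
                  Side i t = N t × c t ≡ i

                  side? : ∀ i → Decidable (Side i)
                  side? i t = N? t ×-dec c t ≟ i

                  side-independent : ∀ i → Independent (Side i)
                  side-independent i (Nt , t≡i) (Ns , s≡i) ts = proper Nt Ns ts (trans t≡i (sym s≡i))

                  split-N : ∀ {t} → N t → ∀ i → c t ≡ i → (Side 0F ∪ Side 1F) t
                  split-N Nt 0F eq = inj₁ (Nt , eq)
                  split-N Nt 1F eq = inj₂ (Nt , eq)

              X-empty : ¬ ∃ X → Colourable 4 G
              X-empty noX = XEmpty.combine noX (XEmpty.N-colouring noX)

              -- Here q₀ is isolated in Q and adjacent to all of N, so q₀ can be merged with v.
              W-empty : ¬ ∃ W → ∃ X → Colourable 4 G
              W-empty noW (t , Xt) = reduce (λ { refl → proj₁ Uv q₀∈ }) (≁-sym (v≁ q₀∈)) apex noTriangle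
                where
                isolated : ∀ {x} → x ∈ Q → q₀ ≁ x
                isolated {x} x∈ q₀x =
                  noPivot⇒avoids-edges noPivot (proj₁ Xt) q₀∈ (x , x∈ , q₀x) a≉q₀ (X-meets Xt q₀∈ a≉q₀)

                q₀~N : ∀ {t} → N t → q₀ ~ t
                q₀~N {t} Nt with N⊆W∪X Nt
                ... | inj₁ Wt = contradiction (t , Wt) noW
                ... | inj₂ Xt = ~-sym (X-meets Xt q₀∈ a≉q₀)

                q₀-only : ∀ {c} → q₀ ~ c → v ≁ c → Y c
                q₀-only {c} q₀c v≁c with classify c
                ... | inQ c∈ = contradiction q₀c (isolated c∈)
                ... | inU Uc with refl ← unique Uc = contradiction (~-sym q₀c) (v≁ q₀∈)
                ... | inY Yc = Yc
                ... | inR Rc = contradiction (v~R Rc) v≁c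

                -- By `q₀-only` c lies in Y and so is complete to Q. And x lies in Q, since U is
                -- {v}, Y is complete to q₀, and R is adjacent to v.
                apex : ∀ {c x} → q₀ ~ c → v ≁ c → x ≢ v → x ≁ q₀ → x ≁ v → c ~ x
                apex {c} {x} q₀c v≁c x≢v x≁q₀ x≁v with classify x
                ... | inQ x∈ = proj₂ (q₀-only q₀c v≁c) x x∈
                ... | inU Ux = contradiction (unique Ux) x≢v
                ... | inY (_ , x~) = contradiction (x~ q₀ q₀∈) x≁q₀
                ... | inR Rx = contradiction (~-sym (v~R Rx)) x≁v

                -- A neighbour y of v lies in Y or R. Being adjacent to c, it is in neither Y nor C,
                -- so it is in N, which is complete to q₀.
                meetsN : ∀ {c y} → Y c → v ≁ c → c ~ y → q₀ ~ y ⊎ v ~ y → q₀ ~ y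
                meetsN Yc v≁c cy (inj₁ q₀y) = q₀y
                meetsN {y = y} Yc v≁c cy (inj₂ vy) with classify y
                ... | inQ y∈ = contradiction vy (v≁ y∈)
                ... | inU Uy with refl ← unique Uy = contradiction vy ~-irrefl
                ... | inY Yy = contradiction cy (Y-independent Yc Yy)
                ... | inR Ry with R⇒C⊎N Ry
                ...   | inj₁ Cy = contradiction cy (YC-independent (inj₁ Yc) (inj₂ Cy))
                ...   | inj₂ Ny = q₀~N Ny

                noTriangle : ∀ {c y z} → q₀ ~ c → v ≁ c → c ~ y → c ~ z → y ~ z →
                             q₀ ~ y ⊎ v ~ y → q₀ ~ z ⊎ v ~ z → ⊥
                noTriangle q₀c v≁c cy cz yz y∈ z∈ =
                  let Yc = q₀-only q₀c v≁c in
                  noK₄ q₀c (meetsN Yc v≁c cy y∈) (meetsN Yc v≁c cz z∈) cy cz yz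

            4-colourable : Colourable 4 G
            4-colourable with pivot?
            ... | yes (t , q , q′ , Nt , q∈ , q′∈ , qq′ , a≉q , tq , tq′) =
              finish W? X? (proj₁ ∘ proj₁) W-independent
                (λ Ww x∈ (y , y∈ , xy) → W-avoids-edges Ww x∈ y∈ xy) X-independent N⊆W∪X
              where open Pivot Nt q∈ q′∈ qq′ a≉q tq tq′
            ... | no noPivot with any? W? | any? X?
              where open NoPivot noPivot
            ...   | yes w | yes x = NoPivot.bothNonempty noPivot w x
            ...   | no noW | yes x = NoPivot.W-empty noPivot noW x
            ...   | _ | no noX = NoPivot.X-empty noPivot noX

        unlinkedTo : ∀ {a} → a ∈ Q → ∃[ q₀ ] q₀ ∈ Q × ¬ a ≈ q₀
        unlinkedTo {a} a∈ with a ≈? left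
        ... | no a≉left = left , left∈ , a≉left
        ... | yes a≈left = right , right∈ , λ a≈right →
          left≉right (≈-trans left∈ a∈ right∈ (≈-sym a≈left) a≈right)

        oneAvoider : Colourable 4 G
        oneAvoider with any? (λ a → any? (λ b → any? (λ e →
                          a Subset.∈? Q ×-dec b Subset.∈? Q ×-dec e Subset.∈? Q
                          ×-dec a ~? b ×-dec a ~? e ×-dec b ~? e)))
        ... | yes (a , b , e , a∈ , b∈ , e∈ , ab , ae , be) =
          let q₀ , q₀∈ , a≉q₀ = unlinkedTo a∈ in Edge.Triangle.4-colourable a∈ b∈ ab q₀∈ a≉q₀ e∈ ae be
        ... | no none =
          let q₀ , q₀∈ , a≉q₀ = unlinkedTo a∈ in
          Edge.TriangleFree.4-colourable a∈ b∈ a~b q₀∈ a≉q₀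
            λ a∈ b∈ e∈ ab ae be → none (_ , _ , _ , a∈ , b∈ , e∈ , ab , ae , be)
          where open Split split using (a∈; b∈; a~b)

      4-colourable : Colourable 4 G
      4-colourable with any? (λ u → U? u ×-dec ¬? (u ≟ anchor))
      ... | yes (u , Uu , u≢) = twoAvoiders Uu avoids u≢
      ... | no none = OneAvoider.oneAvoider avoids λ {u} Uu →
        decidable-stable (u ≟ anchor) λ u≢ → none (u , Uu , u≢)

    4-colourable : ∀ {a b c d} → a ~ b → c ≢ d → c ≁ a → c ≁ b → d ≁ a → d ≁ b → c ≁ d → Colourable 4 G
    4-colourable {a} {b} {c} {d} ab c≢d c≁a c≁b d≁a d≁b c≁d =
      let Q , split , maximal = grow n (ℕ.m≤n+m n _) initial in Frame.4-colourable Q split maximal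
      where
      -- In {a, b, c} the vertex c is isolated, and d serves as the anchor.
      Q₀ : Subset n
      Q₀ = ⁅ a ⁆ Subset.∪ (⁅ b ⁆ Subset.∪ ⁅ c ⁆)

      members : ∀ {x} → x ∈ Q₀ → x ≡ a ⊎ x ≡ b ⊎ x ≡ c
      members x∈ = Sum.map (Subset.x∈⁅y⁆⇒x≡y a)
        (Sum.map (Subset.x∈⁅y⁆⇒x≡y b) (Subset.x∈⁅y⁆⇒x≡y c) ∘ Subset.x∈p∪q⁻ ⁅ b ⁆ ⁅ c ⁆)
        (Subset.x∈p∪q⁻ ⁅ a ⁆ (⁅ b ⁆ Subset.∪ ⁅ c ⁆) x∈)

      a∈ : a ∈ Q₀
      a∈ = Subset.p⊆p∪q _ (Subset.x∈⁅x⁆ a)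

      c∈ : c ∈ Q₀
      c∈ = Subset.q⊆p∪q ⁅ a ⁆ _ (Subset.q⊆p∪q ⁅ b ⁆ _ (Subset.x∈⁅x⁆ c))

      initial : Split Q₀
      initial = record
        { avoids = avoids
        ; a∈ = a∈
        ; b∈ = Subset.q⊆p∪q ⁅ a ⁆ _ (Subset.p⊆p∪q ⁅ c ⁆ (Subset.x∈⁅x⁆ b))
        ; a~b = ab
        ; left∈ = c∈
        ; right∈ = a∈
        ; left≉right = unlinked
        }
        where
        avoids : Avoiding Q₀ d
        avoids = d∉ , d≁
          where
          d∉ : d ∉ Q₀
          d∉ d∈ with members d∈
          ... | inj₁ refl        = d≁b ab
          ... | inj₂ (inj₁ refl) = d≁a (~-sym ab)
          ... | inj₂ (inj₂ refl) = c≢d refl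
          d≁ : ∀ q → q ∈ Q₀ → d ≁ q
          d≁ q q∈ with members q∈
          ... | inj₁ refl        = d≁a
          ... | inj₂ (inj₁ refl) = d≁b
          ... | inj₂ (inj₂ refl) = ≁-sym c≁d

        unlinked : ¬ Linked (_∈ Q₀) c a
        unlinked (inj₁ refl) = c≁b ab
        unlinked (inj₂ (inj₁ ca)) = c≁a ca
        unlinked (inj₂ (inj₂ (z , z∈ , cz , za))) with members z∈
        ... | inj₁ refl        = c≁a cz
        ... | inj₂ (inj₁ refl) = c≁b cz
        ... | inj₂ (inj₂ refl) = ~-irrefl cz

-- Induction on the number of vertices, and the theorem

4-colourable : ∀ n (G : Graph (Fin n)) → Adjacency.NoCoGem G → Adjacency.NoK₄ G → Colourable 4 G
4-colourable zero G _ _ = (λ ()) , λ ()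
4-colourable (suc m) G noCoGem noK₄
  with any? (λ a → any? (λ b → any? (λ c → any? (λ d →
         a ~? b ×-dec ¬? (c ≟ d) ×-dec ¬? (c ~? a) ×-dec ¬? (c ~? b)
           ×-dec ¬? (d ~? a) ×-dec ¬? (d ~? b) ×-dec ¬? (c ~? d)))))
  where open Adjacency G
... | yes (a , b , c , d , ab , c≢d , c≁a , c≁b , d≁a , d≁b , c≁d) =
  CoDiamond.4-colourable G noCoGem noK₄ reduce ab c≢d c≁a c≁b d≁a d≁b c≁d
  where
  open Adjacency G
  reduce : ∀ {u v} → u ≢ v → u ≁ v →
    (∀ {c x} → u ~ c → v ≁ c → x ≢ v → x ≁ u → x ≁ v → c ~ x) →
    (∀ {c y z} → u ~ c → v ≁ c → c ~ y → c ~ z → y ~ z → u ~ y ⊎ v ~ y → u ~ z ⊎ v ~ z → ⊥) →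
    Colourable 4 G
  reduce {u} {v} u≢v u≁v apex noTriangle = unmerge (4-colourable m merged merged-noCoGem merged-noK₄)
    where open Merging.Merge G noCoGem noK₄ u v u≢v u≁v apex noTriangle
... | no none = CoDiamondFree.4-colourable G noCoGem noK₄ λ ab c≢d c≁a c≁b d≁a d≁b c≁d →
  none (_ , _ , _ , _ , ab , c≢d , c≁a , c≁b , d≁a , d≁b , c≁d)

theorem5p1 : ∀ (n : ℕ) (G : Graph (Fin n)) →
    co-gem -Free G → K 4 -Free G → ¬ VertexCritical 5 G
theorem5p1 n G co-gem-free K₄-free ((_ , 5≤) , _) =
  ℕ.<-irrefl refl (5≤ 4 (4-colourable n G (co-gem-Free⇒NoCoGem co-gem-free) (K₄-Free⇒NoK₄ K₄-free)))
  where open Adjacency G
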